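{- If a set $L\subseteq\Sigma^*$ is NP-hard under Karp reductions and $L$ cross-composes into the parameterized problem $Q\subseteq\Sigma^*\times\mathbb{N}$, then there is no polynomial kernel for $Q$ unless $\mathrm{NP}\subseteq\mathrm{coNP/poly}$.
   Context: $\Sigma$ denotes a finite alphabet (different occurrences of $\Sigma$ may refer to different alphabets). A Karp reduction is a polynomial-time many-one reduction. A parameterized problem is a language $Q \subseteq \Sigma^* \times \mathbb{N}$; the second component of an instance is the parameter. Kernel: a kernelization algorithm (kernel) for $Q \subseteq \Sigma^* \times \mathbb{N}$ is an algorithm that, given $(x,k) \in \Sigma^*\times\mathbb{N}$, outputs in $p(|x|+k)$ time, for some polynomial $p$, a pair $(x',k') \in \Sigma^*\times\mathbb{N}$ such that $(x,k)\in Q \Leftrightarrow (x',k')\in Q$ and $|x'|, k' \le f(k)$, where $f$ is a computable function. It is a polynomial kernel if $f$ is a polynomial. Polynomial equivalence relation: an equivalence relation $\mathcal{R}$ on $\Sigma^*$ such that (1) there is an algorithm that given $x,y\in\Sigma^*$ decides whether $x$ and $y$ belong to the same equivalence class in $(|x|+|y|)^{O(1)}$ time; and (2) for any finite set $S\subseteq\Sigma^*$, $\mathcal{R}$ partitions the elements of $S$ into at most $(\max_{x\in S}|x|)^{O(1)}$ classes. Cross-composition: a set $L\subseteq\Sigma^*$ cross-composes into a parameterized problem $Q\subseteq\Sigma^*\times\mathbb{N}$ if there is a polynomial equivalence relation $\mathcal{R}$ and an algorithm which, given $t$ strings $x_1,\dots,x_t$ belonging to the same equivalence class of $\mathcal{R}$,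 computes an instance $(x^*,k^*)\in\Sigma^*\times\mathbb{N}$ in time polynomial in $\sum_{i=1}^t|x_i|$ such that (1) $(x^*,k^*)\in Q \Leftrightarrow x_i\in L$ for some $1\le i\le t$; and (2) $k^*$ is bounded by a polynomial in $\max_{i=1}^t|x_i|+\log t$. -}

module Defs where

open import Data.Bool using (Bool; true; false; T)
open import Data.Fin using (Fin; toℕ)
open import Data.List using (List; []; _∷_; length; map; sum; foldr)
open import Data.List.NonEmpty using (List⁺; toList)
open import Data.List.Relation.Unary.All using (All)
open import Data.List.Relation.Unary.AllPairs using (AllPairs)
open import Data.List.Relation.Unary.Any using (Any)
open import Data.Nat using (ℕ; zero; suc; _+_; _*_; _≤_; _⊔_)
open import Data.Nat.Logarithm using (⌈log₂_⌉)
open import Data.Product using (Σ-syntax; ∃-syntax; _×_; _,_; uncurry)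
open import Function.Bundles using (_⇔_)
open import Level using (0ℓ)
open import Relation.Binary.Core using (Rel)
open import Relation.Binary.Structures using (IsEquivalence)
open import Relation.Binary.PropositionalEquality using (_≡_; _≢_)
open import Relation.Unary using (Pred; ∁)

-- A polynomial with natural coefficients, constant term first.
Poly : Set
Poly = List ℕ

eval : Poly → ℕ → ℕ
eval []       n = 0
eval (c ∷ cs) n = c + n * eval cs n

------------------------------------------------------------------------
-- Algorithms and running time.
--
-- Algorithms are programs of the one-variable WHILE language over binary
-- trees (N. D. Jones, "Computability and Complexity from a Programming
-- Perspective"), every elementary operation having unit cost.  This is
-- realistic: on a pointer representation with sharing, each operation
-- takes constant time, so polynomial time here is polynomial time on
-- Turing machines.  A unit of cost raises the depth of the stored tree
-- by at most one, so although `cons var var` can build trees of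
-- exponential size, the words and (unary) numbers that can be output
-- have length at most linear in the input length plus the running time.

data Tree : Set where
  nil : Tree
  _∙_ : Tree → Tree → Tree

infixr 5 _∙_

hd tl : Tree → Tree
hd nil     = nil
hd (s ∙ t) = s
tl nil     = nil
tl (s ∙ t) = t

data Expr : Set where
  var  : Expr
  nil  : Expr
  cons : Expr → Expr → Expr
  head : Expr → Expr
  tail : Expr → Expr

⟦_⟧ : Expr → Tree → Tree
⟦ var ⟧      v = v
⟦ nil ⟧      v = nil
⟦ cons e f ⟧ v = ⟦ e ⟧ v ∙ ⟦ f ⟧ v
⟦ head e ⟧   v = hd (⟦ e ⟧ v)
⟦ tail e ⟧   v = tl (⟦ e ⟧ v)

cost : Expr → ℕ
cost var        = 1
cost nil        = 1
cost (cons e f) = suc (cost e + cost f)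
cost (head e)   = suc (cost e)
cost (tail e)   = suc (cost e)

data Program : Set where
  assign        : Expr → Program
  _⨾_           : Program → Program → Program
  if_then_else_ : Expr → Program → Program → Program
  while         : Expr → Program → Program

infixr 4 _⨾_
infix 3 _⊢_⇓_⟨_⟩

-- c ⊢ v ⇓ w ⟨ n ⟩: started with the variable holding v, the program c
-- halts with it holding w, at cost n.  The tree nil counts as false and
-- every other tree as true.
data _⊢_⇓_⟨_⟩ : Program → Tree → Tree → ℕ → Set where
  assign     : ∀ {e v} → assign e ⊢ v ⇓ ⟦ e ⟧ v ⟨ suc (cost e) ⟩
  seq        : ∀ {c d u v w m n} →
               c ⊢ u ⇓ v ⟨ m ⟩ → d ⊢ v ⇓ w ⟨ n ⟩ → c ⨾ d ⊢ u ⇓ w ⟨ m + n ⟩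
  if-true    : ∀ {e c d v w n} → ⟦ e ⟧ v ≢ nil → c ⊢ v ⇓ w ⟨ n ⟩ →
               if e then c else d ⊢ v ⇓ w ⟨ suc (cost e + n) ⟩
  if-false   : ∀ {e c d v w n} → ⟦ e ⟧ v ≡ nil → d ⊢ v ⇓ w ⟨ n ⟩ →
               if e then c else d ⊢ v ⇓ w ⟨ suc (cost e + n) ⟩
  while-true : ∀ {e c u v w m n} → ⟦ e ⟧ u ≢ nil →
               c ⊢ u ⇓ v ⟨ m ⟩ → while e c ⊢ v ⇓ w ⟨ n ⟩ →
               while e c ⊢ u ⇓ w ⟨ suc (cost e + m + n) ⟩
  while-false : ∀ {e c v} → ⟦ e ⟧ v ≡ nil →
               while e c ⊢ v ⇓ v ⟨ suc (cost e) ⟩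

------------------------------------------------------------------------
-- Inputs and outputs of algorithms.

-- Words over the alphabet with a letters.
Word : ℕ → Set
Word a = List (Fin a)

Language : ℕ → Set₁
Language a = Pred (Word a) 0ℓ

ParameterizedProblem : ℕ → Set₁
ParameterizedProblem a = Pred (Word a × ℕ) 0ℓ

-- `size` is the quantity in which running times are measured.
record Encodable (X : Set) : Set where
  field
    encode : X → Tree
    size   : X → ℕ

open Encodable ⦃ ... ⦄ public

encodeBool : Bool → Tree
encodeBool false = nil
encodeBool true  = nil ∙ nil

encodeℕ : ℕ → Tree
encodeℕ zero    = nil
encodeℕ (suc n) = nil ∙ encodeℕ n

encodeList : List Tree → Tree
encodeList = foldr _∙_ nil

instance
  encodableBool : Encodable Bool
  encodableBool = record { encode = encodeBool ; size = λ _ → 1 }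

  -- Unary, because a parameter k contributes k to the running time
  -- bound of a kernelization.
  encodableℕ : Encodable ℕ
  encodableℕ = record { encode = encodeℕ ; size = λ n → n }

  encodableWord : ∀ {a} → Encodable (List (Fin a))
  encodableWord = record
    { encode = λ x → encodeList (map (λ i → encodeℕ (toℕ i)) x)
    ; size   = length
    }

  encodable× : ∀ {X Y} → ⦃ Encodable X ⦄ → ⦃ Encodable Y ⦄ → Encodable (X × Y)
  encodable× = record
    { encode = λ (x , y) → encode x ∙ encode y
    ; size   = λ (x , y) → size x + size y
    }

  encodableList⁺ : ∀ {X} → ⦃ Encodable X ⦄ → Encodable (List⁺ X)
  encodableList⁺ = record
    { encode = λ xs → encodeList (map encode (toList xs))
    ; size   = λ xs → sum (map size (toList xs))
    }

_⊢_↦_within_ : {X Y : Set} → ⦃ Encodable X ⦄ → ⦃ Encodable Y ⦄ →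
               Program → X → Y → ℕ → Set
c ⊢ x ↦ y within t = ∃[ n ] n ≤ t × (c ⊢ encode x ⇓ encode y ⟨ n ⟩)

PolyTime : {X Y : Set} → ⦃ Encodable X ⦄ → ⦃ Encodable Y ⦄ → (X → Y) → Set
PolyTime f = ∃[ c ] ∃[ p ] ∀ x → c ⊢ x ↦ f x within eval p (size x)

------------------------------------------------------------------------
-- Complexity classes.

P : {X : Set} → ⦃ Encodable X ⦄ → Pred X 0ℓ → Set
P A = ∃[ d ] PolyTime d × (∀ x → A x ⇔ T (d x))

-- Certificates may use any finite alphabet.
NP : {X : Set} → ⦃ Encodable X ⦄ → Pred X 0ℓ → Set
NP {X} A =
  ∃[ c ] Σ[ verify ∈ (X × Word c → Bool) ] ∃[ p ]
    PolyTime verify ×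
    (∀ x → A x ⇔ (∃[ w ] length w ≤ eval p (size x) × T (verify (x , w))))

coNP : {X : Set} → ⦃ Encodable X ⦄ → Pred X 0ℓ → Set
coNP A = NP (∁ A)

-- The advice depends only on the length of the input.
coNP/poly : ∀ {a} → Language a → Set₁
coNP/poly {a} A =
  ∃[ c ] Σ[ advice ∈ (ℕ → Word c) ] ∃[ p ]
    (∀ n → length (advice n) ≤ eval p n) ×
    (Σ[ B ∈ Pred (Word a × Word c) 0ℓ ]
      coNP B × (∀ x → A x ⇔ B (x , advice (length x))))

NP⊆coNP/poly : Set₁
NP⊆coNP/poly = ∀ {a} (A : Language a) → NP A → coNP/poly A

_KarpReducesTo_ : ∀ {a b} → Language a → Language b → Set
_KarpReducesTo_ {a} {b} A B =
  Σ[ f ∈ (Word a → Word b) ] PolyTime f × (∀ x → A x ⇔ B (f x))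

NPHard : ∀ {b} → Language b → Set₁
NPHard L = ∀ {a} (A : Language a) → NP A → A KarpReducesTo L

------------------------------------------------------------------------
-- Kernels and cross-composition.

record KernelOfSize {b} (Q : ParameterizedProblem b) (f : ℕ → ℕ) : Set where
  field
    kernel     : Word b × ℕ → Word b × ℕ
    polyTime   : PolyTime kernel
    equivalent : ∀ i → Q i ⇔ Q (kernel i)
    bounded    : ∀ x k → let (x′ , k′) = kernel (x , k) in
                 length x′ ≤ f k × k′ ≤ f k

PolynomialKernel : ∀ {b} → ParameterizedProblem b → Set
PolynomialKernel Q = ∃[ p ] KernelOfSize Q (eval p)

maxLength : ∀ {a} → List (Word a) → ℕ
maxLength = foldr (λ x m → length x ⊔ m) 0

record IsPolynomialEquivalence {a} (R : Rel (Word a) 0ℓ) : Set where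
  field
    isEquivalence : IsEquivalence R
    decidableInP  : P (uncurry R)
    -- Every element of S lies in the class of one of at most
    -- `eval classBound (maxLength S)` representatives.
    classBound    : Poly
    fewClasses    : ∀ (S : List (Word a)) →
                    ∃[ reps ] length reps ≤ eval classBound (maxLength S) ×
                              All (λ x → Any (R x) reps) S

-- Nothing is required of the algorithm `compose` on inputs that are not
-- all equivalent; it need not even halt there.
record CrossComposition {a b} (L : Language a) (Q : ParameterizedProblem b)
       : Set₁ where
  field
    R                       : Rel (Word a) 0ℓ
    isPolynomialEquivalence : IsPolynomialEquivalence R
    compose                 : Program
    timeBound               : Poly
    parameterBound          : Poly
    composes : ∀ (xs : List⁺ (Word a)) → AllPairs R (toList xs) →
      Σ[ (x* , k*) ∈ Word b × ℕ ]
        (compose ⊢ xs ↦ (x* , k*) within eval timeBound (size xs)) ×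
        (Q (x* , k*) ⇔ Any L (toList xs)) ×
        k* ≤ eval parameterBound
               (maxLength (toList xs) + ⌈log₂ length (toList xs) ⌉)

{-# OPTIONS --safe #-}

-- Suppose A ∈ NP, and let f reduce A to L.  Many inputs of A of the same
-- length n whose f-images are equivalent can be composed and kernelized
-- into one small instance of Q, which is a yes-instance iff one of the
-- inputs lies in A.  If t inputs are composed and there are fewer than 2 ^ t
-- possible outcomes, a counting argument shows that, among any set of
-- inputs outside A in one class, half occur in t-tuples with a common
-- outcome; hence polynomially many no-instances of Q refute all inputs of
-- length n outside A.  They form the advice, and the tuples are the
-- certificates for non-membership in A.  The argument is applied to A
-- rather than to L because A is decidable, which makes the advice
-- computable, while L need not be.

module Submission where

open import Data.Bool using (Bool; true; false; T; _∧_; _∨_)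
open import Data.Bool.Properties using (T?; T-irrelevant; T-∧; T-∨; ∧-assoc; ∧-identityʳ)
open import Data.Empty using (⊥; ⊥-elim)
open import Data.Fin using (Fin; zero; suc; toℕ)
open import Data.Fin.Properties using (toℕ-injective; toℕ<n) renaming (_≟_ to _≟ᶠ_)
open import Data.List using (List; []; _∷_; _++_; length; map; foldl; filter; allFin; cartesianProductWith; cartesianProduct; upTo)
open import Data.List.Membership.Propositional using (_∈_; find; lose)
open import Data.List.Membership.Propositional.Properties
open import Data.List.NonEmpty using (List⁺; _∷_; toList)
open import Data.List.Properties renaming (≡-dec to List-≡-dec)
open import Data.List.Relation.Unary.All as All using (All; []; _∷_)
import Data.List.Relation.Unary.All.Properties as All
open import Data.List.Relation.Unary.AllPairs using (AllPairs; []; _∷_)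
open import Data.List.Relation.Unary.Any as Any using (Any; here; there; any?)
import Data.List.Relation.Unary.Any.Properties as Any
open import Data.Nat using (ℕ; zero; suc; _+_; _*_; _^_; _≤_; _<_; _⊔_; z≤n; s≤s; _≤?_; _<?_)
open import Data.Nat.ListAction using (sum)
open import Data.Nat.Logarithm using (⌈log₂_⌉; ⌈log₂⌉-mono-≤; ⌈log₂2^n⌉≡n)
open import Data.Nat.Properties
open import Data.Nat.Tactic.RingSolver using (solve-∀)
open import Data.Product using (Σ-syntax; ∃-syntax; _×_; _,_; proj₁; proj₂)
open import Data.Product.Properties using (≡-dec)
open import Data.Sum using (_⊎_; inj₁; inj₂)
open import Data.Unit using (tt)
open import Function using (_∘_; id; flip)
open import Function.Bundles using (_⇔_; mk⇔; Equivalence)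
open import Relation.Binary.PropositionalEquality using (_≡_; _≢_; refl; sym; trans; cong; cong₂; subst)
open import Relation.Binary.Structures using (IsEquivalence)
open import Relation.Nullary using (¬_; Dec; yes; no; ¬?)
open import Relation.Nullary.Decidable using (_×-dec_; map′; decidable-stable)
open import Defs

-- Polynomially bounded functions

-- The number t of composed inputs must exceed the description length of the outcome, while that
-- length in turn depends on t. It does so only through log t, for which v * v is put, with v
-- polynomial in n. The t that this prescribes is polynomial in v, hence at most 2 ^ (v * v) once v
-- exceeds a constant, and the choice is consistent.
--
-- The certificate checker runs the given reduction, equivalence test, composition and
-- kernelization. The composition may diverge on inequivalent words, so equivalence is tested first,
-- and what follows is indexed by a proof that the test succeeded. Membership in Q is never tested:
-- an instance in the advice is known to be a no-instance because some tuple of inputs outside A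
-- distils to it.
--
-- Two measures of trees occur. Running times refer to depth, which grows by at most one per unit of
-- cost. Comparing trees, however, visits their nodes, whose number can be exponential in the depth,
-- so one of the two trees must come from a family with polynomially many nodes.

IsPoly : (ℕ → ℕ) → Set
IsPoly g = ∃[ p ] ∀ n → g n ≡ eval p n

abstract
  const-isPoly : ∀ c → IsPoly (λ _ → c)
  const-isPoly c = c ∷ [] , λ n → sym (trans (cong (c +_) (*-zeroʳ n)) (+-identityʳ c))

  id-isPoly : IsPoly (λ n → n)
  id-isPoly = 0 ∷ 1 ∷ [] , λ n → sym (trans (cong (λ m → n * suc m) (*-zeroʳ n)) (*-identityʳ n))

_⊞_ : Poly → Poly → Poly
[]      ⊞ q       = q
(c ∷ p) ⊞ []      = c ∷ p
(c ∷ p) ⊞ (d ∷ q) = (c + d) ∷ (p ⊞ q)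

eval-⊞ : ∀ p q n → eval (p ⊞ q) n ≡ eval p n + eval q n
eval-⊞ []      q       n = refl
eval-⊞ (c ∷ p) []      n = sym (+-identityʳ _)
eval-⊞ (c ∷ p) (d ∷ q) n rewrite eval-⊞ p q n = lemma c d n (eval p n) (eval q n)
  where
  lemma : ∀ c d n x y → c + d + n * (x + y) ≡ c + n * x + (d + n * y)
  lemma = solve-∀

scale : ℕ → Poly → Poly
scale c = map (c *_)

eval-scale : ∀ c p n → eval (scale c p) n ≡ c * eval p n
eval-scale c []      n = sym (*-zeroʳ c)
eval-scale c (d ∷ p) n rewrite eval-scale c p n = lemma c d n (eval p n)
  where
  lemma : ∀ c d n x → c * d + n * (c * x) ≡ c * (d + n * x)
  lemma = solve-∀

_⊠_ : Poly → Poly → Poly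
[]      ⊠ q = []
(c ∷ p) ⊠ q = scale c q ⊞ (0 ∷ (p ⊠ q))

eval-⊠ : ∀ p q n → eval (p ⊠ q) n ≡ eval p n * eval q n
eval-⊠ []      q n = refl
eval-⊠ (c ∷ p) q n
  rewrite eval-⊞ (scale c q) (0 ∷ (p ⊠ q)) n | eval-scale c q n | eval-⊠ p q n
  = lemma c n (eval p n) (eval q n)
  where
  lemma : ∀ c n x y → c * y + n * (x * y) ≡ (c + n * x) * y
  lemma = solve-∀

abstract
  +-isPoly : ∀ {g h} → IsPoly g → IsPoly h → IsPoly (λ n → g n + h n)
  +-isPoly (p , g≡) (q , h≡) =
    p ⊞ q , λ n → trans (cong₂ _+_ (g≡ n) (h≡ n)) (sym (eval-⊞ p q n))

  *-isPoly : ∀ {g h} → IsPoly g → IsPoly h → IsPoly (λ n → g n * h n)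
  *-isPoly (p , g≡) (q , h≡) =
    p ⊠ q , λ n → trans (cong₂ _*_ (g≡ n) (h≡ n)) (sym (eval-⊠ p q n))

  eval-∘-isPoly : ∀ p {h} → IsPoly h → IsPoly (λ n → eval p (h n))
  eval-∘-isPoly []      H = const-isPoly 0
  eval-∘-isPoly (c ∷ p) H = +-isPoly (const-isPoly c) (*-isPoly H (eval-∘-isPoly p H))

  ∘-isPoly : ∀ {g h} → IsPoly g → IsPoly h → IsPoly (λ n → g (h n))
  ∘-isPoly {g} {h} (p , g≡) H with eval-∘-isPoly p H
  ... | q , e = q , λ n → trans (g≡ (h n)) (e n)

eval-mono : ∀ p {m n} → m ≤ n → eval p m ≤ eval p n
eval-mono []      m≤n = z≤n
eval-mono (c ∷ p) m≤n = +-monoʳ-≤ c (*-mono-≤ m≤n (eval-mono p m≤n))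

mono : ∀ {g} → IsPoly g → ∀ {m n} → m ≤ n → g m ≤ g n
mono (p , g≡) {m} {n} m≤n rewrite g≡ m | g≡ n = eval-mono p m≤n

n<2^n : ∀ n → n < 2 ^ n
n<2^n zero    = s≤s z≤n
n<2^n (suc n) = begin-strict
  suc n             ≤⟨ n<2^n n ⟩
  2 ^ n             <⟨ m<m+n (2 ^ n) (m^n>0 2 n) ⟩
  2 ^ n + 2 ^ n     ≡⟨ cong (2 ^ n +_) (sym (+-identityʳ _)) ⟩
  2 ^ suc n         ∎
  where open ≤-Reasoning

2^-mono : ∀ {m n} → m ≤ n → 2 ^ m ≤ 2 ^ n
2^-mono = ^-monoʳ-≤ 2

-- By `n<2^n`, a Horner step contributes a factor of at most `suc c * suc n ≤ 2 ^ (c + n)`, so the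
-- exponent stays linear in `n`.
eval-≤-2^ : ∀ p → ∃[ d ] ∀ n → eval p n ≤ 2 ^ (d * suc n)
eval-≤-2^ []      = 0 , λ _ → z≤n
eval-≤-2^ (c ∷ p) with eval-≤-2^ p
... | d , bound = c + 1 + d , λ n → let e = 2 ^ (d * suc n) in begin
  c + n * eval p n                    ≤⟨ +-monoʳ-≤ c (*-monoʳ-≤ n (bound n)) ⟩
  c + n * e                           ≤⟨ +-monoˡ-≤ (n * e) (m≤m*n c e ⦃ m^n≢0 2 (d * suc n) ⦄) ⟩
  c * e + n * e                       ≤⟨ m≤m+n _ _ ⟩
  c * e + n * e + (e + c * n * e)     ≡⟨ expand c n e ⟩
  suc c * suc n * e                   ≤⟨ *-monoˡ-≤ e (*-mono-≤ (n<2^n c) (n<2^n n)) ⟩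
  2 ^ c * 2 ^ n * e                   ≡⟨ cong (_* e) (sym (^-distribˡ-+-* 2 c n)) ⟩
  2 ^ (c + n) * e                     ≡⟨ sym (^-distribˡ-+-* 2 (c + n) (d * suc n)) ⟩
  2 ^ (c + n + d * suc n)             ≤⟨ 2^-mono (≤-trans (m≤m+n (c + n + d * suc n) (c * n + 1)) (≤-reflexive (exponent c n d))) ⟩
  2 ^ ((c + 1 + d) * suc n)           ∎
  where
  open ≤-Reasoning
  expand : ∀ c n e → c * e + n * e + (e + c * n * e) ≡ (1 + c) * (1 + n) * e
  expand = solve-∀
  exponent : ∀ c n d → c + n + d * (1 + n) + (c * n + 1) ≡ (c + 1 + d) * (1 + n)
  exponent = solve-∀

-- The exponent D (v + 1) of the crude bound is beaten by v², so the
-- argument only needs v > D.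
abstract
  polynomial-growth : ∀ {g} → IsPoly g → ∃[ D ] ∀ m → let v = m + suc D in g v ≤ 2 ^ (v * v)
  polynomial-growth {g} (p , g≡) with eval-≤-2^ p
  ... | D , bound = D , λ m → let v = m + suc D in begin
    g v                  ≡⟨ g≡ v ⟩
    eval p v             ≤⟨ bound v ⟩
    2 ^ (D * suc v)      ≤⟨ 2^-mono (≤-trans (m≤m+n (D * suc v) (m * m + m * D + 2 * m + 1)) (≤-reflexive (square m D))) ⟩
    2 ^ (v * v)          ∎
    where
    open ≤-Reasoning
    square : ∀ m D → D * (1 + (m + (1 + D))) + (m * m + m * D + 2 * m + 1) ≡ (m + (1 + D)) * (m + (1 + D))
    square = solve-∀

-- Programs and frames

depth : Tree → ℕ
depth nil     = 0
depth (s ∙ t) = suc (depth s ⊔ depth t)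

depth-hd : ∀ t → depth (hd t) ≤ depth t
depth-hd nil     = z≤n
depth-hd (s ∙ t) = m≤n⇒m≤1+n (m≤m⊔n _ _)

depth-tl : ∀ t → depth (tl t) ≤ depth t
depth-tl nil     = z≤n
depth-tl (s ∙ t) = m≤n⇒m≤1+n (m≤n⊔m (depth s) _)

depth-⟦⟧ : ∀ e v → depth (⟦ e ⟧ v) ≤ depth v + cost e
depth-⟦⟧ var        v = m≤m+n _ _
depth-⟦⟧ nil        v = z≤n
depth-⟦⟧ (cons e f) v rewrite +-suc (depth v) (cost e + cost f) =
  s≤s (⊔-lub (≤-trans (depth-⟦⟧ e v) (+-monoʳ-≤ (depth v) (m≤m+n _ _)))
             (≤-trans (depth-⟦⟧ f v) (+-monoʳ-≤ (depth v) (m≤n+m _ _))))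
depth-⟦⟧ (head e)   v =
  ≤-trans (depth-hd (⟦ e ⟧ v)) (≤-trans (depth-⟦⟧ e v) (+-monoʳ-≤ (depth v) (n≤1+n _)))
depth-⟦⟧ (tail e)   v =
  ≤-trans (depth-tl (⟦ e ⟧ v)) (≤-trans (depth-⟦⟧ e v) (+-monoʳ-≤ (depth v) (n≤1+n _)))

depth-⇓ : ∀ {c v w n} → c ⊢ v ⇓ w ⟨ n ⟩ → depth w ≤ depth v + n
depth-⇓ {v = v} (assign {e}) = ≤-trans (depth-⟦⟧ e v) (+-monoʳ-≤ (depth v) (n≤1+n _))
depth-⇓ {v = v} (seq {m = m} {n} r s) =
  ≤-trans (depth-⇓ s) (≤-trans (+-monoˡ-≤ n (depth-⇓ r)) (≤-reflexive (+-assoc (depth v) m n)))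
depth-⇓ {v = v} (if-true {e} _ r) =
  ≤-trans (depth-⇓ r) (+-monoʳ-≤ (depth v) (m≤n⇒m≤1+n (m≤n+m _ (cost e))))
depth-⇓ {v = v} (if-false {e} _ r) =
  ≤-trans (depth-⇓ r) (+-monoʳ-≤ (depth v) (m≤n⇒m≤1+n (m≤n+m _ (cost e))))
depth-⇓ {v = v} (while-true {e} {m = m} {n} _ r s) =
  ≤-trans (depth-⇓ s) (≤-trans (+-monoˡ-≤ n (depth-⇓ r))
    (≤-trans (≤-reflexive (+-assoc (depth v) m n))
      (+-monoʳ-≤ (depth v) (m≤n⇒m≤1+n (+-monoˡ-≤ n (m≤n+m m (cost e)))))))
depth-⇓ (while-false _) = m≤m+n _ _

Run : Program → Tree → Tree → ℕ → Set
Run c u v n = ∃[ m ] m ≤ n × c ⊢ u ⇓ v ⟨ m ⟩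

Run-≤ : ∀ {c u v m n} → m ≤ n → Run c u v m → Run c u v n
Run-≤ m≤n (k , k≤m , r) = k , ≤-trans k≤m m≤n , r

Run-seq : ∀ {c d u v w m n} → Run c u v m → Run d v w n → Run (c ⨾ d) u w (m + n)
Run-seq (_ , p , r) (_ , q , s) = _ , +-mono-≤ p q , seq r s

Run-assign : ∀ e {u} → Run (assign e) u (⟦ e ⟧ u) (suc (cost e))
Run-assign e = _ , ≤-refl , assign

Run-if-true : ∀ {e c d u v n} → ⟦ e ⟧ u ≢ nil → Run c u v n →
              Run (if e then c else d) u v (suc (cost e + n))
Run-if-true {e} t (_ , p , r) = _ , s≤s (+-monoʳ-≤ (cost e) p) , if-true t r

Run-if-false : ∀ {e c d u v n} → ⟦ e ⟧ u ≡ nil → Run d u v n →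
               Run (if e then c else d) u v (suc (cost e + n))
Run-if-false {e} t (_ , p , r) = _ , s≤s (+-monoʳ-≤ (cost e) p) , if-false t r

Run-while-true : ∀ {e c u v w m n} → ⟦ e ⟧ u ≢ nil → Run c u v m → Run (while e c) v w n →
                 Run (while e c) u w (suc (cost e + m + n))
Run-while-true {e} t (_ , p , r) (_ , q , s) =
  _ , s≤s (+-mono-≤ (+-monoʳ-≤ (cost e) p) q) , while-true t r s

Run-while-false : ∀ {e c u} → ⟦ e ⟧ u ≡ nil → Run (while e c) u u (suc (cost e))
Run-while-false t = _ , ≤-refl , while-false t

onHead : Expr → Expr
onHead var        = head var
onHead nil        = nil
onHead (cons e f) = cons (onHead e) (onHead f)
onHead (head e)   = head (onHead e)
onHead (tail e)   = tail (onHead e)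

⟦onHead⟧ : ∀ e v r → ⟦ onHead e ⟧ (v ∙ r) ≡ ⟦ e ⟧ v
⟦onHead⟧ var        v r = refl
⟦onHead⟧ nil        v r = refl
⟦onHead⟧ (cons e f) v r = cong₂ _∙_ (⟦onHead⟧ e v r) (⟦onHead⟧ f v r)
⟦onHead⟧ (head e)   v r = cong hd (⟦onHead⟧ e v r)
⟦onHead⟧ (tail e)   v r = cong tl (⟦onHead⟧ e v r)

cost-onHead : ∀ e → cost (onHead e) ≤ cost e + cost e
cost-onHead var        = ≤-refl
cost-onHead nil        = n≤1+n 1
cost-onHead (cons e f) = s≤s (≤-trans (+-mono-≤ (cost-onHead e) (cost-onHead f))
  (≤-trans (n≤1+n _) (≤-reflexive (lemma (cost e) (cost f)))))
  where
  lemma : ∀ x y → 1 + (x + x + (y + y)) ≡ x + y + (1 + (x + y))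
  lemma = solve-∀
cost-onHead (head e)   = s≤s (≤-trans (cost-onHead e) (+-monoʳ-≤ (cost e) (n≤1+n _)))
cost-onHead (tail e)   = s≤s (≤-trans (cost-onHead e) (+-monoʳ-≤ (cost e) (n≤1+n _)))

-- With a single variable, data needed later can only be kept beside the data in use: the program
-- works on the head of the store and leaves the tail alone.
frame : Program → Program
frame (assign e)             = assign (cons (onHead e) (tail var))
frame (c ⨾ d)                = frame c ⨾ frame d
frame (if e then c else d)   = if onHead e then frame c else frame d
frame (while e c)            = while (onHead e) (frame c)

private
  4*-suc : ∀ c n {c′ n′} → c′ ≤ 4 * c → n′ ≤ 4 * n → suc (c′ + n′) ≤ 4 * suc (c + n)
  4*-suc c n {c′} {n′} p q = begin
    suc (c′ + n′)         ≤⟨ s≤s (+-mono-≤ p q) ⟩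
    suc (4 * c + 4 * n)   ≤⟨ m≤m+n _ 3 ⟩
    suc (4 * c + 4 * n) + 3 ≡⟨ lemma c n ⟩
    4 * suc (c + n)       ∎
    where
    open ≤-Reasoning
    lemma : ∀ c n → 1 + (4 * c + 4 * n) + 3 ≡ 4 * (1 + (c + n))
    lemma = solve-∀

  cost-onHead-4* : ∀ e → cost (onHead e) ≤ 4 * cost e
  cost-onHead-4* e = ≤-trans (cost-onHead e) (≤-trans (m≤m+n _ _) (≤-reflexive (lemma (cost e))))
    where
    lemma : ∀ x → x + x + (x + x) ≡ 4 * x
    lemma = solve-∀

-- An assignment decides the factor: `onHead` at most doubles its expression, rebuilding the pair
-- costs 3 more, and the assignment itself 1, in all at most `4 + 2 * cost e`.
frame-⇓ : ∀ {c v w n} r → c ⊢ v ⇓ w ⟨ n ⟩ → Run (frame c) (v ∙ r) (w ∙ r) (4 * n)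
frame-⇓ {v = v} r (assign {e}) =
  subst (λ t → Run _ _ (t ∙ r) _) (⟦onHead⟧ e v r)
    (_ , ≤-trans (s≤s (s≤s (+-monoˡ-≤ 2 (cost-onHead e))))
                 (≤-trans (m≤m+n _ (cost e + cost e)) (≤-reflexive (lemma (cost e)))) , assign)
  where
  lemma : ∀ x → 2 + (x + x + 2) + (x + x) ≡ 4 * (1 + x)
  lemma = solve-∀
frame-⇓ r (seq {m = m} {n} p q) =
  Run-≤ (≤-reflexive (sym (*-distribˡ-+ 4 m n))) (Run-seq (frame-⇓ r p) (frame-⇓ r q))
frame-⇓ {v = v} r (if-true {e} {n = n} t p) =
  Run-≤ (4*-suc (cost e) n (cost-onHead-4* e) ≤-refl)
    (Run-if-true (λ z → t (trans (sym (⟦onHead⟧ e v r)) z)) (frame-⇓ r p))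
frame-⇓ {v = v} r (if-false {e} {n = n} t p) =
  Run-≤ (4*-suc (cost e) n (cost-onHead-4* e) ≤-refl)
    (Run-if-false (trans (⟦onHead⟧ e v r) t) (frame-⇓ r p))
frame-⇓ {v = v} r (while-true {e} {m = m} {n} t p q) =
  Run-≤ (4*-suc (cost e + m) n (≤-trans (+-monoˡ-≤ (4 * m) (cost-onHead-4* e))
                         (≤-reflexive (sym (*-distribˡ-+ 4 (cost e) m)))) ≤-refl)
    (Run-while-true (λ z → t (trans (sym (⟦onHead⟧ e v r)) z)) (frame-⇓ r p) (frame-⇓ r q))
frame-⇓ {v = v} r (while-false {e} t) =
  Run-≤ (≤-trans (≤-reflexive (cong suc (sym (+-identityʳ _))))
                 (≤-trans (4*-suc (cost e) 0 (cost-onHead-4* e) z≤n)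
                          (≤-reflexive (cong (λ x → 4 * suc x) (+-identityʳ (cost e))))))
    (Run-while-false (trans (⟦onHead⟧ e v r) t))

-- Polynomial-time transformations of trees

infix 3 _⟹_

-- Time is measured in the depth of the input instead of its size because
-- the depth grows by at most the running time, so that ⟹ composes.
record _⟹_ {A : Set} (u v : A → Tree) : Set where
  field
    program : Program
    time    : ℕ → ℕ
    isPoly  : IsPoly time
    runs    : ∀ a → Run program (u a) (v a) (time (depth (u a)))

open _⟹_

nil? : (t : Tree) → Dec (t ≡ nil)
nil? nil     = yes refl
nil? (s ∙ t) = no λ ()

frame-Run : ∀ {c u v n} r → Run c u v n → Run (frame c) (u ∙ r) (v ∙ r) (4 * n)
frame-Run r (_ , m≤n , p) = Run-≤ (*-monoʳ-≤ 4 m≤n) (frame-⇓ r p)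

module _ {A : Set} where

  infixl 4 _▸_

  assign⟹ : ∀ {u : A → Tree} e → u ⟹ (λ a → ⟦ e ⟧ (u a))
  assign⟹ e = record
    { program = assign e
    ; time    = λ _ → suc (cost e)
    ; isPoly  = const-isPoly (suc (cost e))
    ; runs    = λ a → Run-assign e
    }

  depth-⟹ : ∀ {u v : A → Tree} (p : u ⟹ v) a → depth (v a) ≤ depth (u a) + time p (depth (u a))
  depth-⟹ {u} p a with runs p a
  ... | _ , n≤ , r = ≤-trans (depth-⇓ r) (+-monoʳ-≤ (depth (u a)) n≤)

  _▸_ : ∀ {u v w : A → Tree} → u ⟹ v → v ⟹ w → u ⟹ w
  p ▸ q = record
    { program = program p ⨾ program q
    ; time    = λ n → time p n + time q (n + time p n)
    ; isPoly  = +-isPoly (isPoly p) (∘-isPoly (isPoly q) (+-isPoly id-isPoly (isPoly p)))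
    ; runs    = λ a → Run-seq (runs p a) (Run-≤ (mono (isPoly q) (depth-⟹ p a)) (runs q a))
    }

  ⟹-resp : ∀ {u v w : A → Tree} → u ⟹ v → (∀ a → v a ≡ w a) → u ⟹ w
  ⟹-resp p eq = record
    { program = program p
    ; time    = time p
    ; isPoly  = isPoly p
    ; runs    = λ a → subst (λ t → Run _ _ t _) (eq a) (runs p a)
    }

  -- Indices carry what a tree does not show, such as decoded values and proofs. Changing them
  -- leaves the program as it is.
  reindex : ∀ {B : Set} {u v : A → Tree} (g : B → A) → u ⟹ v → (λ b → u (g b)) ⟹ (λ b → v (g b))
  reindex g p = record
    { program = program p
    ; time    = time p
    ; isPoly  = isPoly p
    ; runs    = λ b → runs p (g b)
    }

  frame⟹ : ∀ {u v r : A → Tree} → u ⟹ v → (λ a → u a ∙ r a) ⟹ (λ a → v a ∙ r a)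
  frame⟹ {r = r} p = record
    { program = frame (program p)
    ; time    = λ n → 4 * time p n
    ; isPoly  = *-isPoly (const-isPoly 4) (isPoly p)
    ; runs    = λ a → Run-≤ (*-monoʳ-≤ 4 (mono (isPoly p) (m≤n⇒m≤1+n (m≤m⊔n _ _))))
                            (frame-Run (r a) (runs p a))
    }

  ⟨_,_⟩⟹ : ∀ {u v w : A → Tree} → u ⟹ v → u ⟹ w → u ⟹ (λ a → v a ∙ w a)
  ⟨ p , q ⟩⟹ = assign⟹ (cons var var) ▸ frame⟹ p ▸ assign⟹ swap ▸ frame⟹ q ▸ assign⟹ swap
    where
    swap : Expr
    swap = cons (tail var) (head var)

  -- The outcome of the test joins the index, so each branch has to be correct, and even to halt,
  -- only on the stores that reach it.
  branch⟹ : ∀ {u v : A → Tree} e →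
            (λ (x : Σ[ a ∈ A ] ⟦ e ⟧ (u a) ≢ nil) → u (proj₁ x)) ⟹ (λ x → v (proj₁ x)) →
            (λ (x : Σ[ a ∈ A ] ⟦ e ⟧ (u a) ≡ nil) → u (proj₁ x)) ⟹ (λ x → v (proj₁ x)) →
            u ⟹ v
  branch⟹ {u} {v} e p q = record
    { program = if e then program p else program q
    ; time    = t
    ; isPoly  = +-isPoly (const-isPoly (suc (cost e))) (+-isPoly (isPoly p) (isPoly q))
    ; runs    = run
    }
    where
    t : ℕ → ℕ
    t n = suc (cost e) + (time p n + time q n)
    run : ∀ a → Run _ (u a) (v a) (t (depth (u a)))
    run a with nil? (⟦ e ⟧ (u a))
    ... | no ≢nil  = Run-if-true ≢nil (Run-≤ (m≤m+n _ _) (runs p (a , ≢nil)))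
    ... | yes ≡nil = Run-if-false ≡nil (Run-≤ (m≤n+m _ _) (runs q (a , ≡nil)))

-- A conjunction whose second half may use a proof of the first. It is needed because the distilled
-- instance exists only for lists that pass the equivalence test.
andThen : (b : Bool) → (T b → Bool) → Bool
andThen false f = false
andThen true  f = f tt

T-andThen⁻ : ∀ b {f} → T (andThen b f) → Σ[ t ∈ T b ] T (f t)
T-andThen⁻ true t = tt , t

T-andThen⁺ : ∀ b {f} (t : T b) → T (f t) → T (andThen b f)
T-andThen⁺ true tt t = t

guard⟹ : ∀ {A : Set} {u : A → Tree} {d : A → Bool} {f : (a : A) → T (d a) → Bool} →
         u ⟹ (λ a → encodeBool (d a)) →
         (λ (x : Σ[ a ∈ A ] T (d a)) → u (proj₁ x)) ⟹ (λ (a , t) → encodeBool (f a t)) →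
         u ⟹ (λ a → encodeBool (andThen (d a) (f a)))
guard⟹ {A} {u} {d} {f} p q =
  ⟨ p , assign⟹ var ⟩⟹ ▸ branch⟹ (head var)
    (⟹-resp (assign⟹ (tail var) ▸ reindex (λ (a , t) → a , holds (d a) t) q)
            (λ (a , t) → passed (d a) (holds (d a) t)))
    (⟹-resp (assign⟹ nil) (λ (a , t) → failed (d a) t))
  where
  holds : ∀ b → encodeBool b ≢ nil → T b
  holds false t = ⊥-elim (t refl)
  holds true  t = tt
  passed : ∀ b {f} (t : T b) → encodeBool (f t) ≡ encodeBool (andThen b f)
  passed true tt = refl
  failed : ∀ b {f} → encodeBool b ≡ nil → nil ≡ encodeBool (andThen b f)
  failed false t = refl

length≤depth : ∀ {I : Set} (i : I → Tree) xs → length xs ≤ depth (encodeList (map i xs))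
length≤depth i []       = z≤n
length≤depth i (x ∷ xs) = s≤s (≤-trans (length≤depth i xs) (m≤n⊔m (depth (i x)) _))

-- The additive growth condition keeps the accumulator polynomially deep
-- throughout the loop.
module Fold {I Acc : Set} (i : I → Tree) (q : Acc → Tree) (step : Acc → I → Acc)
  {h : ℕ → ℕ} (h-isPoly : IsPoly h)
  (growth : ∀ acc x → depth (q (step acc x)) ≤ depth (q acc) + h (depth (i x)))
  (body : (λ ((acc , x) : Acc × I) → i x ∙ q acc) ⟹ (λ (acc , x) → q (step acc x)))
  where

  private
    -- `fetch` turns `(x ∙ xs) ∙ acc` into `(x ∙ acc) ∙ xs`, where the framed `body` can run on the
    -- head; `store` then restores the order of list and accumulator.
    fetch store : Expr
    fetch = cons (cons (head (head var)) (tail var)) (tail (head var))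
    store = cons (tail var) (head var)

    loop : Program
    loop = while (head var) (assign fetch ⨾ (frame (program body) ⨾ assign store))

    iteration : ℕ → ℕ → ℕ
    iteration D E = suc (cost fetch) + (4 * time body (suc (D + E)) + suc (cost store))

    -- `E` bounds the accumulator together with all growth still to come. Thus `D` and `E` stay
    -- fixed in the induction, and all iterations share one cost bound.
    loop-run : ∀ D E xs acc → depth (encodeList (map i xs)) ≤ D →
               depth (q acc) + length xs * h D ≤ E →
               Run loop (encodeList (map i xs) ∙ q acc) (nil ∙ q (foldl step acc xs))
                   (length xs * (3 + iteration D E) + 3)
    loop-run D E []       acc ≤D ≤E = Run-while-false refl
    loop-run D E (x ∷ xs) acc ≤D ≤E =
      Run-≤ (≤-reflexive (cong suc (sym (+-assoc (2 + iteration D E) (length xs * (3 + iteration D E)) 3))))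
        (Run-while-true (λ ())
          (Run-seq (Run-assign fetch)
            (Run-seq (frame-Run (encodeList (map i xs)) (Run-≤ (mono (isPoly body) body≤) (runs body (acc , x))))
                     (Run-assign store)))
          (loop-run D E xs (step acc x) tail≤ acc≤))
      where
      head≤ : depth (i x) ≤ D
      head≤ = ≤-trans (m≤n⇒m≤1+n (m≤m⊔n _ _)) ≤D
      tail≤ : depth (encodeList (map i xs)) ≤ D
      tail≤ = ≤-trans (m≤n⇒m≤1+n (m≤n⊔m (depth (i x)) _)) ≤D
      body≤ : depth (i x ∙ q acc) ≤ suc (D + E)
      body≤ = s≤s (⊔-lub (≤-trans head≤ (m≤m+n D E))
                         (≤-trans (≤-trans (m≤m+n _ _) ≤E) (m≤n+m E D)))
      acc≤ : depth (q (step acc x)) + length xs * h D ≤ E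
      acc≤ = ≤-trans (+-monoˡ-≤ (length xs * h D)
                       (≤-trans (growth acc x) (+-monoʳ-≤ (depth (q acc)) (mono h-isPoly head≤))))
             (≤-trans (≤-reflexive (+-assoc (depth (q acc)) (h D) (length xs * h D))) ≤E)

  fold⟹ : (λ ((acc , xs) : Acc × List I) → encodeList (map i xs) ∙ q acc) ⟹
          (λ (acc , xs) → q (foldl step acc xs))
  fold⟹ = record
    { program = loop ⨾ assign (tail var)
    ; time    = λ n → n * (3 + iteration n (n + n * h n)) + 3 + 3
    ; isPoly  = +-isPoly (+-isPoly (*-isPoly id-isPoly (+-isPoly (const-isPoly 3)
                  (+-isPoly (const-isPoly (suc (cost fetch)))
                    (+-isPoly (*-isPoly (const-isPoly 4) (∘-isPoly (isPoly body) E-isPoly))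
                              (const-isPoly (suc (cost store)))))))
                  (const-isPoly 3)) (const-isPoly 3)
    ; runs    = run
    }
    where
    E-isPoly : IsPoly (λ n → suc (n + (n + n * h n)))
    E-isPoly = +-isPoly (const-isPoly 1) (+-isPoly id-isPoly (+-isPoly id-isPoly (*-isPoly id-isPoly h-isPoly)))
    run : ∀ ax → Run _ _ _ _
    run (acc , xs) = Run-seq
      (Run-≤ (+-monoˡ-≤ 3 (*-monoˡ-≤ (3 + iteration d (d + d * h d)) length≤))
        (loop-run d (d + d * h d) xs acc (≤-trans (n≤1+n _) list<)
          (+-mono-≤ (m≤n⇒m≤1+n (m≤n⊔m (depth (encodeList (map i xs))) _)) (*-monoˡ-≤ (h d) length≤))))
      (Run-assign (tail var))
      where
      d : ℕ
      d = depth (encodeList (map i xs) ∙ q acc)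
      list< : depth (encodeList (map i xs)) < d
      list< = s≤s (m≤m⊔n _ _)
      length≤ : length xs ≤ d
      length≤ = ≤-trans (length≤depth i xs) (≤-trans (n≤1+n _) list<)

open Fold using (fold⟹)

-- Programs on lists and codes

fromPolyTime : ∀ {X Y : Set} ⦃ _ : Encodable X ⦄ ⦃ _ : Encodable Y ⦄ {f : X → Y} {h} → IsPoly h →
               (∀ (x : X) → size x ≤ h (depth (encode x))) → PolyTime f →
               (λ (x : X) → encode x) ⟹ (λ x → encode (f x))
fromPolyTime {h = h} h-isPoly size≤ (c , p , run) = record
  { program = c
  ; time    = λ n → eval p (h n)
  ; isPoly  = eval-∘-isPoly p h-isPoly
  ; runs    = λ x → Run-≤ (eval-mono p (size≤ x)) (run x)
  }

toPolyTime : ∀ {X Y : Set} ⦃ _ : Encodable X ⦄ ⦃ _ : Encodable Y ⦄ {f : X → Y} {h} → IsPoly h →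
             (∀ (x : X) → depth (encode x) ≤ h (size x)) →
             (λ (x : X) → encode x) ⟹ (λ x → encode (f x)) → PolyTime f
toPolyTime h-isPoly depth≤ r with ∘-isPoly (isPoly r) h-isPoly
... | p , time≡ = program r , p , λ x →
  Run-≤ (≤-trans (mono (isPoly r) (depth≤ x)) (≤-reflexive (time≡ (size x)))) (runs r x)

depth-encodeℕ : ∀ n → depth (encodeℕ n) ≡ n
depth-encodeℕ zero    = refl
depth-encodeℕ (suc n) = cong suc (depth-encodeℕ n)

letter : ∀ {a} → Fin a → Tree
letter i = encodeℕ (toℕ i)

depth-word≤ : ∀ {a} (x : Word a) → depth (encode x) ≤ length x + a
depth-word≤ []          = z≤n
depth-word≤ {a} (i ∷ x) = s≤s (⊔-lub
  (≤-trans (≤-reflexive (depth-encodeℕ (toℕ i))) (≤-trans (<⇒≤ (toℕ<n i)) (m≤n+m a _)))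
  (depth-word≤ x))

length-word≤ : ∀ {a} (x : Word a) → length x ≤ depth (encode x)
length-word≤ = length≤depth letter

nodes : Tree → ℕ
nodes nil     = 1
nodes (s ∙ t) = suc (nodes s + nodes t)

nodes-encodeℕ : ∀ n → nodes (encodeℕ n) ≡ 2 * n + 1
nodes-encodeℕ zero    = refl
nodes-encodeℕ (suc n) = trans (cong (2 +_) (nodes-encodeℕ n)) (lemma n)
  where
  lemma : ∀ n → 2 + (2 * n + 1) ≡ 2 * (1 + n) + 1
  lemma = solve-∀

nodes-encodeList≤ : ∀ {I : Set} (i : I → Tree) k xs → (∀ {x} → x ∈ xs → nodes (i x) ≤ k) →
                    nodes (encodeList (map i xs)) ≤ length xs * suc k + 1
nodes-encodeList≤ i k []       ≤k = ≤-refl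
nodes-encodeList≤ i k (x ∷ xs) ≤k = s≤s (≤-trans
  (+-mono-≤ (≤k (here refl)) (nodes-encodeList≤ i k xs (≤k ∘ there)))
  (≤-reflexive (sym (+-assoc k (length xs * suc k) 1))))

nodes-word≤ : ∀ {a} (x : Word a) → nodes (encode x) ≤ length x * suc (2 * a + 1) + 1
nodes-word≤ {a} x = nodes-encodeList≤ letter (2 * a + 1) x λ {i} _ →
  ≤-trans (≤-reflexive (nodes-encodeℕ (toℕ i))) (+-monoˡ-≤ 1 (*-monoʳ-≤ 2 (<⇒≤ (toℕ<n i))))

-- Full binary trees have exponentially many nodes for their depth; this condition singles out the
-- families on which a node-by-node traversal is polynomial.
record Thin {B : Set} (u : B → Tree) : Set where
  field
    {bound} : ℕ → ℕ
    isPoly  : IsPoly bound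
    nodes≤  : ∀ b → nodes (u b) ≤ bound (depth (u b))

thin-word : ∀ {a} → Thin {Word a} encode
thin-word {a} = record
  { bound  = λ n → n * suc (2 * a + 1) + 1
  ; isPoly = +-isPoly (*-isPoly id-isPoly (const-isPoly _)) (const-isPoly 1)
  ; nodes≤ = λ x → ≤-trans (nodes-word≤ x) (+-monoˡ-≤ 1 (*-monoˡ-≤ (suc (2 * a + 1)) (length-word≤ x)))
  }

thin-ℕ : Thin encodeℕ
thin-ℕ = record
  { bound  = λ n → 2 * n + 1
  ; isPoly = +-isPoly (*-isPoly (const-isPoly 2) id-isPoly) (const-isPoly 1)
  ; nodes≤ = λ n → ≤-reflexive (trans (nodes-encodeℕ n) (cong (λ d → 2 * d + 1) (sym (depth-encodeℕ n))))
  }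

thin-∙ : ∀ {B C : Set} {u : B → Tree} {v : C → Tree} → Thin u → Thin v → Thin {B × C} (λ (b , c) → u b ∙ v c)
thin-∙ U V = record
  { bound  = λ n → suc (bound U n + bound V n)
  ; isPoly = +-isPoly (const-isPoly 1) (+-isPoly (isPoly U) (isPoly V))
  ; nodes≤ = λ (b , c) → s≤s (+-mono-≤
      (≤-trans (nodes≤ U b) (mono (isPoly U) (m≤n⇒m≤1+n (m≤m⊔n _ _))))
      (≤-trans (nodes≤ V c) (mono (isPoly V) (m≤n⇒m≤1+n (m≤n⊔m _ _)))))
  }
  where open Thin

-- Equality and membership tests

_==_ : Tree → Tree → Bool
nil      == nil      = true
nil      == (_ ∙ _)  = false
(_ ∙ _)  == nil      = false
(s ∙ s′) == (t ∙ t′) = (s == t) ∧ (s′ == t′)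

==-refl : ∀ t → T (t == t)
==-refl nil     = tt
==-refl (s ∙ t) = Equivalence.from T-∧ (==-refl s , ==-refl t)

==⇒≡ : ∀ s t → T (s == t) → s ≡ t
==⇒≡ nil      nil      _ = refl
==⇒≡ (s ∙ s′) (t ∙ t′) e with Equivalence.to T-∧ e
... | p , q = cong₂ _∙_ (==⇒≡ s t p) (==⇒≡ s′ t′ q)

module TreeEquality where

  private
    left right rest : Expr
    left  = head (head (head var))
    right = tail (head (head var))
    rest  = tail (head var)

    -- The store holds a stack of pairs of trees still to be compared and
    -- a truth value.
    push pop fail : Expr
    push = cons (cons (cons (head left) (head right)) (cons (cons (tail left) (tail right)) rest)) (tail var)
    pop  = cons rest (tail var)
    fail = cons nil nil

    loop : Program
    loop = while (head var)
      (if left then (if right then assign push else assign fail)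
               else (if right then assign fail else assign pop))

    -- The run on the remaining stack `r` is a premise, so that recursion on the two trees suffices
    -- whatever lies below them. A mismatch empties the stack and makes no use of that run.
    loop-run : ∀ s t r b n → Run loop (r ∙ encodeBool true) (nil ∙ encodeBool b) n →
               Run loop (((s ∙ t) ∙ r) ∙ encodeBool true) (nil ∙ encodeBool ((s == t) ∧ b)) (n + 60 * nodes s)
    loop-run nil nil r b n rest-run =
      Run-≤ (≤-trans (+-monoˡ-≤ n (≤ᵇ⇒≤ 20 60 tt)) (≤-reflexive (+-comm 60 n)))
        (Run-while-true (λ ()) (Run-if-false refl (Run-if-false refl (Run-assign pop))) rest-run)
    loop-run nil (_ ∙ _) r b n rest-run =
      Run-≤ (≤-trans (≤ᵇ⇒≤ _ 60 tt) (m≤n+m 60 n))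
        (Run-while-true (λ ()) (Run-if-false refl (Run-if-true (λ ()) (Run-assign fail))) (Run-while-false refl))
    loop-run (s ∙ s′) nil r b n rest-run =
      Run-≤ (≤-trans (≤ᵇ⇒≤ _ 60 tt) (≤-trans (*-monoʳ-≤ 60 (s≤s (z≤n {nodes s + nodes s′}))) (m≤n+m _ n)))
        (Run-while-true (λ ()) (Run-if-true (λ ()) (Run-if-false refl (Run-assign fail))) (Run-while-false refl))
    loop-run (s ∙ s′) (t ∙ t′) r b n rest-run =
      subst (λ b → Run loop _ (nil ∙ encodeBool b) _) (sym (∧-assoc (s == t) (s′ == t′) b))
        -- The most expensive iteration is this one, with `push`, at cost 44; 60 per node of the
        -- left tree leaves room.
        (Run-≤ (≤-trans (+-monoˡ-≤ (n + 60 * nodes s′ + 60 * nodes s) (≤ᵇ⇒≤ 44 60 tt))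
                        (≤-reflexive (lemma 60 n (nodes s) (nodes s′))))
          (Run-while-true (λ ()) (Run-if-true (λ ()) (Run-if-true (λ ()) (Run-assign push)))
            (loop-run s t ((s′ ∙ t′) ∙ r) ((s′ == t′) ∧ b) (n + 60 * nodes s′)
              (loop-run s′ t′ r b n rest-run))))
      where
      lemma : ∀ k n x y → k + (n + k * y + k * x) ≡ n + k * (1 + (x + y))
      lemma = solve-∀

  -- Thinness of the left family is enough, since the comparison stops at the first mismatch and so
  -- never leaves the shape of the left tree. The right tree may then be an arbitrary one decoded
  -- from the advice.
  ==⟹ : ∀ {A : Set} {u v : A → Tree} → Thin u → (λ a → u a ∙ v a) ⟹ (λ a → encodeBool (u a == v a))
  ==⟹ {A} {u} {v} thin = record
    { program = assign start ⨾ (loop ⨾ assign (tail var))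
    ; time    = λ n → suc (cost start) + (3 + 60 * bound n + 3)
    ; isPoly  = +-isPoly (const-isPoly (suc (cost start))) (+-isPoly (+-isPoly (const-isPoly 3)
                  (*-isPoly (const-isPoly 60) (Thin.isPoly thin))) (const-isPoly 3))
    ; runs    = λ a → Run-seq (Run-assign start) (Run-seq
        (Run-≤ (+-monoʳ-≤ 3 (*-monoʳ-≤ 60 (≤-trans (nodes≤ a) (mono (Thin.isPoly thin) (m≤n⇒m≤1+n (m≤m⊔n _ _))))))
          (subst (λ b → Run loop (((u a ∙ v a) ∙ nil) ∙ encodeBool true) (nil ∙ encodeBool b) (3 + 60 * nodes (u a))) (∧-identityʳ (u a == v a))
            (loop-run (u a) (v a) nil true 3 (Run-while-false refl))))
        (Run-assign (tail var)))
    }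
    where
    open Thin thin using (bound; nodes≤)
    start : Expr
    start = cons (cons var nil) (cons nil nil)

open TreeEquality using (==⟹)

depth-encodeBool≤ : ∀ b → depth (encodeBool b) ≤ 1
depth-encodeBool≤ false = z≤n
depth-encodeBool≤ true  = ≤-refl

depth-flag≤ : ∀ (t : Tree) b b′ → depth (t ∙ encodeBool b′) ≤ depth (t ∙ encodeBool b) + 1
depth-flag≤ t b b′ = s≤s (⊔-lub
  (≤-trans (m≤m⊔n (depth t) (depth (encodeBool b))) (m≤m+n _ 1))
  (≤-trans (depth-encodeBool≤ b′) (m≤n+m 1 _)))

or⟹ : (λ ((b , c) : Bool × Bool) → encodeBool b ∙ encodeBool c) ⟹ (λ (b , c) → encodeBool (b ∨ c))
or⟹ = branch⟹ (head var)
  (⟹-resp (assign⟹ (cons nil nil)) λ { ((true , _) , _) → refl ; ((false , _) , t) → ⊥-elim (t refl) })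
  (⟹-resp (assign⟹ (tail var)) λ { ((false , _) , _) → refl })

module Member {B I : Set} (u : B → Tree) (thin : Thin u) (i : I → Tree) where

  private
    step : B × Bool → I → B × Bool
    step (b , found) y = b , found ∨ (u b == i y)

    step⟹ : (λ (((b , found) , y) : (B × Bool) × I) → i y ∙ (u b ∙ encodeBool found)) ⟹
            (λ ((b , found) , y) → u b ∙ encodeBool (found ∨ (u b == i y)))
    step⟹ = ⟨ assign⟹ (head (tail var))
            , ⟨ assign⟹ (tail (tail var))
              , assign⟹ (cons (head (tail var)) (head var))
                ▸ reindex (λ ((b , _) , y) → b , y) (==⟹ (record { isPoly = Thin.isPoly thin ; nodes≤ = λ (b , _) → Thin.nodes≤ thin b }))
              ⟩⟹ ▸ reindex (λ ((b , found) , y) → found , (u b == i y)) or⟹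
            ⟩⟹

    found : B × Bool → List I → Bool
    found acc ys = proj₂ (foldl step acc ys)

    T-found⁻ : ∀ b f ys → T (found (b , f) ys) → T f ⊎ Any (λ y → u b ≡ i y) ys
    T-found⁻ b f []       t = inj₁ t
    T-found⁻ b f (y ∷ ys) t with T-found⁻ b (f ∨ (u b == i y)) ys t
    ... | inj₂ p = inj₂ (there p)
    ... | inj₁ p with Equivalence.to T-∨ p
    ...   | inj₁ q = inj₁ q
    ...   | inj₂ q = inj₂ (here (==⇒≡ _ _ q))

    T-found⁺ : ∀ b f ys → T f ⊎ Any (λ y → u b ≡ i y) ys → T (found (b , f) ys)
    T-found⁺ b f []       (inj₁ t)         = t
    T-found⁺ b f (y ∷ ys) (inj₁ t)         = T-found⁺ b _ ys (inj₁ (Equivalence.from T-∨ (inj₁ t)))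
    T-found⁺ b f (y ∷ ys) (inj₂ (here e))  = T-found⁺ b _ ys
      (inj₁ (Equivalence.from (T-∨ {f}) (inj₂ (subst (λ t → T (u b == t)) e (==-refl (u b))))))
    T-found⁺ b f (y ∷ ys) (inj₂ (there p)) = T-found⁺ b _ ys (inj₂ p)

  member : B × List I → Bool
  member (b , ys) = found (b , false) ys

  member⁻ : ∀ b ys → T (member (b , ys)) → Any (λ y → u b ≡ i y) ys
  member⁻ b ys t with T-found⁻ b false ys t
  ... | inj₂ p = p

  member⁺ : ∀ b ys → Any (λ y → u b ≡ i y) ys → T (member (b , ys))
  member⁺ b ys p = T-found⁺ b false ys (inj₂ p)

  member⟹ : (λ ((b , ys) : B × List I) → u b ∙ encodeList (map i ys)) ⟹ (λ bys → encodeBool (member bys))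
  member⟹ = assign⟹ (cons (tail var) (cons (head var) nil))
    ▸ reindex (λ (b , ys) → (b , false) , ys)
        (fold⟹ i (λ (b , f) → u b ∙ encodeBool f) step (const-isPoly 1)
               (λ (b , f) y → depth-flag≤ (u b) f _) step⟹)
    ▸ assign⟹ (tail var)

-- Lists of words as words: the letter zero starts a new word, the letter
-- suc i is prepended to the current word.

module ListCode {a : ℕ} where

  private
    step : List⁺ (Word a) → Fin (suc a) → List⁺ (Word a)
    step (x ∷ xs) zero    = [] ∷ (x ∷ xs)
    step (x ∷ xs) (suc i) = (i ∷ x) ∷ xs

    step⟹ : (λ ((acc , i) : List⁺ (Word a) × Fin (suc a)) → letter i ∙ encode acc) ⟹
            (λ (acc , i) → encode (step acc i))
    step⟹ = branch⟹ (head var)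
      (⟹-resp (assign⟹ (cons (cons (tail (head var)) (head (tail var))) (tail (tail var))))
        λ { ((_ , zero) , t) → ⊥-elim (t refl) ; ((_ , suc _) , _) → refl })
      (⟹-resp (assign⟹ (cons nil (tail var)))
        λ { ((_ , zero) , _) → refl ; ((_ , suc _) , ()) })

    growth : ∀ acc i → depth (encode (step acc i)) ≤ depth (encode acc) + suc (depth (letter i))
    growth acc      zero    = ≤-reflexive (sym (+-comm (depth (encode acc)) 1))
    growth (x ∷ xs) (suc i) = s≤s (⊔-lub
      (≤-trans (s≤s (⊔-lub (m≤n+m _ X) (≤-trans (m≤m⊔n _ _) (m≤m+n X di))))
               (≤-trans (≤-reflexive (sym (+-suc X di))) (+-monoʳ-≤ X (n≤1+n _))))
      (≤-trans (m≤n⊔m (depth (encode x)) _) (m≤m+n X _)))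
      where
      X di : ℕ
      X  = depth (encode x) ⊔ depth (encodeList (map encode xs))
      di = depth (letter i)

    -- `spell` and `code′` write their parts in reverse, because decoding prepends letters to the
    -- current word and new words to the list.
    spell : Word a → Word (suc a)
    spell []      = []
    spell (i ∷ x) = spell x ++ suc i ∷ []

    foldl-spell : ∀ x xs → foldl step ([] ∷ xs) (spell x) ≡ x ∷ xs
    foldl-spell []      xs = refl
    foldl-spell (i ∷ x) xs
      rewrite foldl-++ step ([] ∷ xs) (spell x) (suc i ∷ []) | foldl-spell x xs = refl

    length-spell : ∀ x → length (spell x) ≡ length x
    length-spell []      = refl
    length-spell (i ∷ x) rewrite length-++ (spell x) {suc i ∷ []} | length-spell x = +-comm (length x) 1

    code′ : Word a → List (Word a) → Word (suc a)
    code′ x []       = spell x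
    code′ x (y ∷ ys) = code′ y ys ++ zero ∷ spell x

  -- Every word decodes to a nonempty list, so there are no malformed certificates to reject.
  decode : Word (suc a) → List⁺ (Word a)
  decode = foldl step ([] ∷ [])

  decode⟹ : (λ (w : Word (suc a)) → encode w) ⟹ (λ w → encode (decode w))
  decode⟹ = assign⟹ (cons var (cons nil nil))
    ▸ reindex (λ w → ([] ∷ []) , w)
        (fold⟹ letter encode step (+-isPoly (const-isPoly 1) id-isPoly) growth step⟹)

  code : List⁺ (Word a) → Word (suc a)
  code (x ∷ xs) = code′ x xs

  decode-code : ∀ xs → decode (code xs) ≡ xs
  decode-code (x ∷ xs) = go x xs
    where
    go : ∀ x xs → decode (code′ x xs) ≡ x ∷ xs
    go x []       = foldl-spell x []
    go x (y ∷ ys)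
      rewrite foldl-++ step ([] ∷ []) (code′ y ys) (zero ∷ spell x) | go y ys
      = foldl-spell x (y ∷ ys)

  length-code≤ : ∀ n xs → All (λ x → length x ≤ n) (toList xs) →
                 length (code xs) ≤ length (toList xs) * suc n
  length-code≤ n (x ∷ [])     (≤n ∷ [])
    rewrite length-spell x = ≤-trans ≤n (≤-trans (n≤1+n n) (≤-reflexive (sym (+-identityʳ (suc n)))))
  length-code≤ n (x ∷ y ∷ ys) (≤n ∷ ≤ns)
    rewrite length-++ (code′ y ys) {zero ∷ spell x} | length-spell x
    = ≤-trans (+-mono-≤ (length-code≤ n (y ∷ ys) ≤ns) (s≤s ≤n)) (≤-reflexive (+-comm _ (suc n)))

-- Trees as words in postfix notation, decoded by a stack machine.

module TreeCode where

  private
    step : Tree → Fin 2 → Tree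
    step s zero    = nil ∙ s
    step s (suc _) = (hd (tl s) ∙ hd s) ∙ tl (tl s)

    step⟹ : (λ ((s , i) : Tree × Fin 2) → letter i ∙ s) ⟹ (λ (s , i) → step s i)
    step⟹ = branch⟹ (head var)
      (⟹-resp (assign⟹ (cons (cons (head (tail (tail var))) (head (tail var))) (tail (tail (tail var)))))
        λ { ((_ , zero) , t) → ⊥-elim (t refl) ; ((_ , suc _) , _) → refl })
      (⟹-resp (assign⟹ (cons nil (tail var)))
        λ { ((_ , zero) , _) → refl ; ((_ , suc _) , ()) })

    growth : ∀ s i → depth (step s i) ≤ depth s + 2
    growth s zero    = ≤-trans (n≤1+n _) (≤-reflexive (+-comm 2 (depth s)))
    growth s (suc _) = ≤-trans
      (s≤s (⊔-lub (s≤s (⊔-lub (≤-trans (depth-hd (tl s)) (depth-tl s)) (depth-hd s)))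
                  (≤-trans (≤-trans (depth-tl (tl s)) (depth-tl s)) (n≤1+n _))))
      (≤-reflexive (+-comm 2 (depth s)))

  -- One code for all trees spares separate codes for words, numbers, pairs and lists. Its length is
  -- the number of nodes, so bounding the advice amounts to counting nodes.
  code : Tree → Word 2
  code nil     = zero ∷ []
  code (s ∙ t) = code s ++ code t ++ suc zero ∷ []

  decode : Word 2 → Tree
  decode w = hd (foldl step nil w)

  decode⟹ : (λ (w : Word 2) → encode w) ⟹ decode
  decode⟹ = assign⟹ (cons var nil)
    ▸ reindex (λ w → nil , w) (fold⟹ letter id step (const-isPoly 2) growth step⟹)
    ▸ assign⟹ (head var)

  private
    push-code : ∀ t s → foldl step s (code t) ≡ t ∙ s
    push-code nil      s = refl
    push-code (t ∙ t′) s
      rewrite foldl-++ step s (code t) (code t′ ++ suc zero ∷ []) | push-code t s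
            | foldl-++ step (t ∙ s) (code t′) (suc zero ∷ []) | push-code t′ (t ∙ s) = refl

  decode-code : ∀ t → decode (code t) ≡ t
  decode-code t = cong hd (push-code t nil)

  length-code : ∀ t → length (code t) ≡ nodes t
  length-code nil     = refl
  length-code (s ∙ t)
    rewrite length-++ (code s) {code t ++ suc zero ∷ []} | length-++ (code t) {suc zero ∷ []}
          | length-code s | length-code t
    = trans (cong (nodes s +_) (+-comm (nodes t) 1)) (+-suc (nodes s) (nodes t))

spine : Tree → List Tree
spine nil     = []
spine (s ∙ t) = s ∷ spine t

encodeList-spine : ∀ t → encodeList (map id (spine t)) ≡ t
encodeList-spine nil     = refl
encodeList-spine (s ∙ t) = cong (s ∙_) (encodeList-spine t)

spine-encodeList : ∀ ts → spine (encodeList ts) ≡ ts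
spine-encodeList []       = refl
spine-encodeList (t ∷ ts) = cong (t ∷_) (spine-encodeList ts)

-- Double counting

private
  sum-map-0 : ∀ {V : Set} (ys : List V) → sum (map (λ _ → 0) ys) ≡ 0
  sum-map-0 []       = refl
  sum-map-0 (_ ∷ ys) = sum-map-0 ys

  sum-map-≥ : ∀ {V : Set} (f : V → ℕ) k ys → (∀ {y} → y ∈ ys → k ≤ f y) → length ys * k ≤ sum (map f ys)
  sum-map-≥ f k []       k≤ = z≤n
  sum-map-≥ f k (y ∷ ys) k≤ = +-mono-≤ (k≤ (here refl)) (sum-map-≥ f k ys (k≤ ∘ there))

  sum-map-≤ : ∀ {V : Set} (f : V → ℕ) k ys → (∀ {y} → y ∈ ys → f y ≤ k) → sum (map f ys) ≤ length ys * k
  sum-map-≤ f k []       ≤k = z≤n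
  sum-map-≤ f k (y ∷ ys) ≤k = +-mono-≤ (≤k (here refl)) (sum-map-≤ f k ys (≤k ∘ there))

  sum-map-2* : ∀ {V : Set} (f : V → ℕ) ys → sum (map (λ y → 2 * f y) ys) ≡ 2 * sum (map f ys)
  sum-map-2* f []       = refl
  sum-map-2* f (y ∷ ys) rewrite sum-map-2* f ys = sym (*-distribˡ-+ 2 (f y) (sum (map f ys)))

length-filter-¬ : ∀ {X : Set} {P : X → Set} (P? : ∀ x → Dec (P x)) xs →
                  length (filter P? xs) + length (filter (¬? ∘ P?) xs) ≡ length xs
length-filter-¬ P? []       = refl
length-filter-¬ P? (x ∷ xs) with P? x
... | yes _ = cong suc (length-filter-¬ P? xs)
... | no _  = trans (+-suc _ _) (cong suc (length-filter-¬ P? xs))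

module Covering {X V : Set} (C : X → V → Set) (C? : ∀ x y → Dec (C x y)) where

  row : List V → X → List V
  row Y x = filter (C? x) Y

  column : List X → V → List X
  column S y = filter (λ x → C? x y) S

  private
    lemma : ∀ k m n → k + (m + n) ≡ m + (k + n)
    lemma = solve-∀

    double-count-∷ : ∀ x S Y → sum (map (λ y → length (column (x ∷ S) y)) Y) ≡
                               length (row Y x) + sum (map (λ y → length (column S y)) Y)
    double-count-∷ x S []      = refl
    double-count-∷ x S (y ∷ Y) with C? x y
    ... | yes _ = cong suc (trans (cong (length (column S y) +_) (double-count-∷ x S Y)) (lemma (length (column S y)) (length (row Y x)) (sum (map (λ y → length (column S y)) Y))))
    ... | no _  = trans (cong (length (column S y) +_) (double-count-∷ x S Y)) (lemma (length (column S y)) (length (row Y x)) (sum (map (λ y → length (column S y)) Y)))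

  double-count : ∀ S Y → sum (map (λ x → length (row Y x)) S) ≡ sum (map (λ y → length (column S y)) Y)
  double-count []      Y = sym (sum-map-0 Y)
  double-count (x ∷ S) Y = trans (cong (length (row Y x) +_) (double-count S Y)) (sym (double-count-∷ x S Y))

  -- Averaging: if every row held more than half of `Y`, counting the related pairs by rows would
  -- give more than counting them by columns.
  sparse-row : ∀ S Y → 0 < length S → (∀ {y} → y ∈ Y → 2 * length (column S y) ≤ length S) →
               ∃[ x ] x ∈ S × 2 * length (row Y x) ≤ length Y
  sparse-row S Y 0<S sparse with any? (λ x → 2 * length (row Y x) ≤? length Y) S
  ... | yes p = find p
  ... | no ¬p = ⊥-elim (<⇒≱ (m<n+m (length Y * length S) 0<S) (begin
    length S + length Y * length S                    ≡⟨ *-comm (suc (length Y)) (length S) ⟩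
    length S * suc (length Y)                         ≤⟨ sum-map-≥ _ _ S (λ x∈S → ≰⇒> (λ q → ¬p (lose x∈S q))) ⟩
    sum (map (λ x → 2 * length (row Y x)) S)          ≡⟨ sum-map-2* _ S ⟩
    2 * sum (map (λ x → length (row Y x)) S)          ≡⟨ cong (2 *_) (double-count S Y) ⟩
    2 * sum (map (λ y → length (column S y)) Y)       ≡⟨ sum-map-2* _ Y ⟨
    sum (map (λ y → 2 * length (column S y)) Y)       ≤⟨ sum-map-≤ _ _ Y sparse ⟩
    length Y * length S                               ∎))
    where open ≤-Reasoning

  -- Choosing a sparse row halves the number of columns that contain all
  -- elements chosen so far.
  uncovered-tuple : ∀ S → 0 < length S → ∀ k Y → length Y < 2 ^ k →
                    (∀ {y} → y ∈ Y → 2 * length (column S y) ≤ length S) →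
                    ∃[ xs ] length xs ≡ k × All (_∈ S) xs × (∀ {y} → y ∈ Y → ¬ All (λ x → C x y) xs)
  uncovered-tuple S 0<S zero    []      Y<   sparse = [] , refl , [] , λ ()
  uncovered-tuple S 0<S zero    (_ ∷ _) (s≤s ()) sparse
  uncovered-tuple S 0<S (suc k) Y Y< sparse with sparse-row S Y 0<S sparse
  ... | x , x∈S , half
    with uncovered-tuple S 0<S k (row Y x) (*-cancelˡ-< 2 _ _ (≤-<-trans half Y<))
                         (λ y∈ → sparse (proj₁ (∈-filter⁻ (C? x) {xs = Y} y∈)))
  ... | xs , len , xs⊆S , uncovered =
    x ∷ xs , cong suc len , x∈S ∷ xs⊆S , λ { y∈Y (c ∷ cs) → uncovered (∈-filter⁺ (C? x) y∈Y c) cs }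

  module _ (S : List X) (Y : List V) (t : ℕ) (Y< : length Y < 2 ^ t)
           (tuple-covered : ∀ xs → length xs ≡ t → All (_∈ S) xs → ∃[ y ] y ∈ Y × All (λ x → C x y) xs)
           where

    -- Were all columns sparse on `S′`, `uncovered-tuple` would yield `t` elements without a common
    -- column. Tuples may repeat elements, so `S′` may have fewer than `t` of them.
    dense-column : ∀ S′ → 0 < length S′ → (∀ {x} → x ∈ S′ → x ∈ S) →
                   ∃[ y ] length S′ < 2 * length (column S′ y)
    dense-column S′ 0<S′ S′⊆S with any? (λ y → length S′ <? 2 * length (column S′ y)) Y
    ... | yes p = let y , _ , dense = find p in y , dense
    ... | no ¬p with uncovered-tuple S′ 0<S′ t Y Y< (λ y∈Y → ≮⇒≥ (λ q → ¬p (lose y∈Y q)))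
    ...   | xs , len , xs⊆S′ , uncovered with tuple-covered xs len (All.map S′⊆S xs⊆S′)
    ...     | y , y∈Y , covered = ⊥-elim (uncovered y∈Y covered)

    -- Greedy choice: a dense column takes away more than half of what is left, so the exponent `k`
    -- drops by one each time.
    cover : ∀ k S′ → length S′ < 2 ^ k → (∀ {x} → x ∈ S′ → x ∈ S) →
            ∃[ ys ] length ys ≤ k × All (λ y → ∃[ x ] C x y) ys × (∀ {x} → x ∈ S′ → Any (C x) ys)
    cover k       []         S′< S′⊆S = [] , z≤n , [] , λ ()
    cover zero    (_ ∷ _)    (s≤s ()) S′⊆S
    cover (suc k) S′@(_ ∷ _) S′< S′⊆S with dense-column S′ (s≤s z≤n) S′⊆S
    ... | y , dense with cover k (filter (λ x → ¬? (C? x y)) S′) rest< (λ x∈ → S′⊆S (proj₁ (∈-filter⁻ (λ x → ¬? (C? x y)) {xs = S′} x∈)))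
      where
      rest : ℕ
      rest = length (filter (λ x → ¬? (C? x y)) S′)
      rest< : rest < 2 ^ k
      rest< = *-cancelˡ-< 2 _ _ (≤-<-trans (+-cancelʳ-≤ (length S′) _ _ (begin
        2 * rest + length S′                         ≤⟨ +-monoʳ-≤ (2 * rest) (<⇒≤ dense) ⟩
        2 * rest + 2 * length (column S′ y)          ≡⟨ *-distribˡ-+ 2 rest _ ⟨
        2 * (rest + length (column S′ y))            ≡⟨ cong (2 *_) (+-comm rest _) ⟩
        2 * (length (column S′ y) + rest)            ≡⟨ cong (2 *_) (length-filter-¬ (λ x → C? x y) S′) ⟩
        2 * length S′                                ≡⟨ cong (length S′ +_) (+-identityʳ _) ⟩
        length S′ + length S′                        ∎)) S′<)
        where open ≤-Reasoning
    ...   | ys , ys≤k , good , covers = y ∷ ys , s≤s ys≤k , witness (column S′ y) refl ∷ good , covers′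
      where
      -- A dense column is nonempty. The element found here later provides a tuple outside `A` that
      -- distils to the chosen instance.
      witness : ∀ xs → xs ≡ column S′ y → ∃[ x ] C x y
      witness []       eq rewrite sym eq = ⊥-elim (n≮0 dense)
      witness (x ∷ xs) eq = x , proj₂ (∈-filter⁻ (λ x → C? x y) {xs = S′} (subst (x ∈_) eq (here refl)))
      covers′ : ∀ {x} → x ∈ S′ → Any (C x) (y ∷ ys)
      covers′ {x} x∈S′ with C? x y
      ... | yes c = here c
      ... | no ¬c = there (covers (∈-filter⁺ (λ x → ¬? (C? x y)) x∈S′ ¬c))

-- Enumeration of tuples and of words of bounded length

length-cartesianProductWith : ∀ {X Y Z : Set} (f : X → Y → Z) xs ys →
                              length (cartesianProductWith f xs ys) ≡ length xs * length ys
length-cartesianProductWith f []       ys = refl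
length-cartesianProductWith f (x ∷ xs) ys =
  trans (length-++ (map (f x) ys)) (cong₂ _+_ (length-map (f x) ys) (length-cartesianProductWith f xs ys))

tuples : ∀ {X : Set} → List X → ℕ → List (List X)
tuples S zero    = [] ∷ []
tuples S (suc t) = cartesianProductWith _∷_ S (tuples S t)

∈-tuples⁺ : ∀ {X : Set} {S : List X} t {xs} → length xs ≡ t → All (_∈ S) xs → xs ∈ tuples S t
∈-tuples⁺ zero    {[]}     refl []           = here refl
∈-tuples⁺ (suc t) {x ∷ xs} refl (x∈S ∷ xs⊆S) = ∈-cartesianProductWith⁺ _∷_ x∈S (∈-tuples⁺ t refl xs⊆S)

∈-tuples⁻ : ∀ {X : Set} {S : List X} t {xs} → xs ∈ tuples S t → length xs ≡ t × All (_∈ S) xs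
∈-tuples⁻         zero    (here refl) = refl , []
∈-tuples⁻ {S = S} (suc t) xs∈ with ∈-cartesianProductWith⁻ _∷_ S (tuples S t) xs∈
... | x , xs , x∈S , xs∈′ , refl with ∈-tuples⁻ t xs∈′
...   | len , xs⊆S = cong suc len , x∈S ∷ xs⊆S

words≤ : ∀ b → ℕ → List (Word b)
words≤ b zero    = [] ∷ []
words≤ b (suc n) = [] ∷ cartesianProductWith _∷_ (allFin b) (words≤ b n)

∈-words≤ : ∀ {b} n (x : Word b) → length x ≤ n → x ∈ words≤ b n
∈-words≤ zero    []      _         = here refl
∈-words≤ (suc n) []      _         = here refl
∈-words≤ (suc n) (i ∷ x) (s≤s len) = there (∈-cartesianProductWith⁺ _∷_ (∈-allFin i) (∈-words≤ n x len))

length-words≤ : ∀ b n → length (words≤ b n) ≤ 2 ^ (b * n)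
length-words≤ b zero    rewrite *-zeroʳ b = ≤-refl
length-words≤ b (suc n) = begin
  suc (length (cartesianProductWith _∷_ (allFin b) (words≤ b n)))
    ≡⟨ cong suc (length-cartesianProductWith _∷_ (allFin b) (words≤ b n)) ⟩
  suc (length (allFin b) * length (words≤ b n))
    ≡⟨ cong (λ k → suc (k * length (words≤ b n))) (length-tabulate (id {A = Fin b})) ⟩
  suc (b * length (words≤ b n))
    ≤⟨ +-mono-≤ (m^n>0 2 (b * n)) (*-monoʳ-≤ b (length-words≤ b n)) ⟩
  suc b * 2 ^ (b * n)
    ≤⟨ *-monoˡ-≤ (2 ^ (b * n)) (n<2^n b) ⟩
  2 ^ b * 2 ^ (b * n)
    ≡⟨ ^-distribˡ-+-* 2 b (b * n) ⟨
  2 ^ (b + b * n)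
    ≡⟨ cong (2 ^_) (*-suc b n) ⟨
  2 ^ (b * suc n) ∎
  where open ≤-Reasoning

-- The distillation and the advice

certified? : ∀ {c} (accept : Word c → Bool) n → Dec (∃[ w ] length w ≤ n × T (accept w))
certified? {c} accept n with any? (λ w → (length w ≤? n) ×-dec T? (accept w)) (words≤ c n)
... | yes p = let w , _ , q = find p in yes (w , q)
... | no ¬p = no λ (w , len , t) → ¬p (lose (∈-words≤ n w len) (len , t))

maxLength≤ : ∀ {a} n (xs : List (Word a)) → (∀ {x} → x ∈ xs → length x ≤ n) → maxLength xs ≤ n
maxLength≤ n []       ≤n = z≤n
maxLength≤ n (x ∷ xs) ≤n = ⊔-lub (≤n (here refl)) (maxLength≤ n xs (≤n ∘ there))

size-pair≤ : ∀ {l} (p : Word l × Word l) → size p ≤ depth (encode p) + depth (encode p)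
size-pair≤ (x , y) = +-mono-≤
  (≤-trans (length-word≤ x) (m≤n⇒m≤1+n (m≤m⊔n _ _)))
  (≤-trans (length-word≤ y) (m≤n⇒m≤1+n (m≤n⊔m (depth (encode x)) _)))

size-instance≤ : ∀ {b} (i : Word b × ℕ) → size i ≤ depth (encode i) + depth (encode i)
size-instance≤ (x , k) = +-mono-≤
  (≤-trans (length-word≤ x) (m≤n⇒m≤1+n (m≤m⊔n _ _)))
  (≤-trans (≤-reflexive (sym (depth-encodeℕ k))) (m≤n⇒m≤1+n (m≤n⊔m (depth (encode x)) _)))

-- There is no converse bound: empty words add to the depth of a list but not to its size.
size-list≤ : ∀ {l} (zs : List⁺ (Word l)) → size zs ≤ depth (encode zs) * depth (encode zs)
size-list≤ {l} zs = ≤-trans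
  (sum-lengths≤ (toList zs) ≤-refl)
  (*-monoˡ-≤ (depth (encode zs)) (length≤depth encode (toList zs)))
  where
  D : ℕ
  D = depth (encode zs)
  sum-lengths≤ : (ys : List (Word l)) → depth (encodeList (map encode ys)) ≤ D → sum (map length ys) ≤ length ys * D
  sum-lengths≤ []       _  = z≤n
  sum-lengths≤ (y ∷ ys) ≤D = +-mono-≤
    (≤-trans (length-word≤ y) (≤-trans (m≤n⇒m≤1+n (m≤m⊔n _ _)) ≤D))
    (sum-lengths≤ ys (≤-trans (m≤n⇒m≤1+n (m≤n⊔m (depth (encode y)) _)) ≤D))

encodeℕ-injective : ∀ {m n} → encodeℕ m ≡ encodeℕ n → m ≡ n
encodeℕ-injective {m} {n} eq = trans (sym (depth-encodeℕ m)) (trans (cong depth eq) (depth-encodeℕ n))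

encode-word-injective : ∀ {a} (x y : Word a) → encode x ≡ encode y → x ≡ y
encode-word-injective []      []      _  = refl
encode-word-injective (i ∷ x) (j ∷ y) eq =
  cong₂ _∷_ (toℕ-injective (encodeℕ-injective (cong hd eq))) (encode-word-injective x y (cong tl eq))

encode-instance-injective : ∀ {b} (i j : Word b × ℕ) → encode i ≡ encode j → i ≡ j
encode-instance-injective (x , k) (y , m) eq =
  cong₂ _,_ (encode-word-injective x y (cong hd eq)) (encodeℕ-injective (cong tl eq))

module Reduction
  {a l b : ℕ} {L : Language l} {Q : ParameterizedProblem b}
  (crossComposition : CrossComposition L Q) (polynomialKernel : PolynomialKernel Q)
  (A : Language a) (A? : ∀ x → Dec (A x))
  (f : Word a → Word l) (f-polyTime : PolyTime f) (f-reduces : ∀ x → A x ⇔ L (f x))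
  where

  open CrossComposition crossComposition
  open IsPolynomialEquivalence isPolynomialEquivalence
  open KernelOfSize (proj₂ polynomialKernel) using (kernel; equivalent; bounded) renaming (polyTime to kernel-polyTime)
  module R = IsEquivalence isEquivalence

  kernelBound : Poly
  kernelBound = proj₁ polynomialKernel

  f⟹ : (λ (x : Word a) → encode x) ⟹ (λ x → encode (f x))
  f⟹ = fromPolyTime {f = f} id-isPoly length-word≤ f-polyTime

  -- The fold reverses the tail, which is harmless because only the length and the members of the
  -- list matter.
  images : List⁺ (Word a) → List⁺ (Word l)
  images (x ∷ xs) = f x ∷ foldl (λ zs y → f y ∷ zs) [] xs

  images⟹ : (λ (xs : List⁺ (Word a)) → encode xs) ⟹ (λ xs → encode (images xs))
  images⟹ = ⟨ assign⟹ (head var) ▸ reindex (λ (x ∷ _) → x) f⟹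
            , assign⟹ (cons (tail var) nil)
              ▸ reindex (λ (_ ∷ xs) → [] , xs)
                  (fold⟹ encode (λ zs → encodeList (map encode zs)) (λ zs y → f y ∷ zs)
                    (+-isPoly (const-isPoly 1) (+-isPoly id-isPoly (isPoly f⟹)))
                    growth (frame⟹ (reindex proj₂ f⟹)))
            ⟩⟹
    where
    growth : ∀ (zs : List (Word l)) y → depth (encode (f y) ∙ encodeList (map encode zs)) ≤
             depth (encodeList (map encode zs)) + suc (depth (encode y) + time f⟹ (depth (encode y)))
    growth zs y = ≤-trans
      (s≤s (⊔-lub (≤-trans (depth-⟹ f⟹ y) (m≤n+m _ D)) (m≤m+n D _)))
      (≤-reflexive (sym (+-suc D _)))
      where
      D : ℕ
      D = depth (encodeList (map encode zs))

  images-tail : ∀ (zs : List (Word l)) xs → foldl (λ zs y → f y ∷ zs) zs xs ≡ foldl (flip _∷_) zs (map f xs)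
  images-tail zs []       = refl
  images-tail zs (x ∷ xs) = images-tail (f x ∷ zs) xs

  length-images : ∀ xs → length (toList (images xs)) ≡ length (toList xs)
  length-images (x ∷ xs) rewrite images-tail [] xs =
    cong suc (trans (length-reverse (map f xs)) (length-map f xs))

  Any-images⁺ : ∀ {P : Word l → Set} xs → Any (P ∘ f) (toList xs) → Any P (toList (images xs))
  Any-images⁺ (x ∷ xs) (here p)  = here p
  Any-images⁺ (x ∷ xs) (there p) rewrite images-tail [] xs = there (Any.reverse⁺ (Any.map⁺ p))

  Any-images⁻ : ∀ {P : Word l → Set} xs → Any P (toList (images xs)) → Any (P ∘ f) (toList xs)
  Any-images⁻ (x ∷ xs) (here p)  = here p
  Any-images⁻ (x ∷ xs) (there p) rewrite images-tail [] xs = there (Any.map⁻ (Any.reverse⁻ p))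

  ∈-images⁻ : ∀ {z} xs → z ∈ toList (images xs) → ∃[ x ] x ∈ toList xs × z ≡ f x
  ∈-images⁻ xs z∈ = find (Any-images⁻ xs z∈)

  related : Word l × Word l → Bool
  related = proj₁ decidableInP

  related⟹ : (λ (p : Word l × Word l) → encode p) ⟹ (λ p → encodeBool (related p))
  related⟹ = fromPolyTime {f = related} (+-isPoly id-isPoly id-isPoly) size-pair≤ (proj₁ (proj₂ decidableInP))

  R⇔related : ∀ x y → R x y ⇔ T (related (x , y))
  R⇔related x y = proj₂ (proj₂ decidableInP) (x , y)

  R? : ∀ x y → Dec (R x y)
  R? x y = map′ (Equivalence.from (R⇔related x y)) (Equivalence.to (R⇔related x y)) (T? (related (x , y)))

  consistentStep : Word l × Bool → Word l → Word l × Bool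
  consistentStep (z , ok) y = z , andThen ok (λ _ → related (z , y))

  consistent : List⁺ (Word l) → Bool
  consistent (z ∷ zs) = proj₂ (foldl consistentStep (z , true) zs)

  consistent⟹ : (λ (zs : List⁺ (Word l)) → encode zs) ⟹ (λ zs → encodeBool (consistent zs))
  consistent⟹ = assign⟹ (cons (tail var) (cons (head var) (cons nil nil)))
    ▸ reindex (λ (z ∷ zs) → (z , true) , zs)
        (fold⟹ encode (λ (z , ok) → encode z ∙ encodeBool ok) consistentStep (const-isPoly 1)
          (λ (z , ok) y → depth-flag≤ (encode z) ok _) step⟹)
    ▸ assign⟹ (tail var)
    where
    step⟹ : (λ (((z , ok) , y) : (Word l × Bool) × Word l) → encode y ∙ (encode z ∙ encodeBool ok)) ⟹
            (λ ((z , ok) , y) → encode z ∙ encodeBool (andThen ok (λ _ → related (z , y))))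
    step⟹ = ⟨ assign⟹ (head (tail var))
            , guard⟹ (assign⟹ (tail (tail var)))
                (assign⟹ (cons (head (tail var)) (head var)) ▸ reindex (λ (((z , _) , y) , _) → z , y) related⟹)
            ⟩⟹

  consistent⁻ : ∀ z zs → T (consistent (z ∷ zs)) → All (R z) zs
  consistent⁻ z zs = proj₂ ∘ go true zs
    where
    go : ∀ ok zs → T (proj₂ (foldl consistentStep (z , ok) zs)) → T ok × All (R z) zs
    go ok []       t = t , []
    go ok (y ∷ ys) t with go _ ys t
    ... | u , all with T-andThen⁻ ok u
    ...   | t′ , r = t′ , Equivalence.from (R⇔related z y) r ∷ all

  consistent⁺ : ∀ z zs → All (R z) zs → T (consistent (z ∷ zs))
  consistent⁺ z zs = go true zs tt
    where
    go : ∀ ok zs → T ok → All (R z) zs → T (proj₂ (foldl consistentStep (z , ok) zs))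
    go ok []       t []       = t
    go ok (y ∷ ys) t (r ∷ rs) = go _ ys (T-andThen⁺ ok t (Equivalence.to (R⇔related z y) r)) rs

  -- Each element is compared with the first one only; symmetry and transitivity of `R` give the
  -- remaining pairs.
  consistent⇒AllPairs : ∀ zs → T (consistent zs) → AllPairs R (toList zs)
  consistent⇒AllPairs (z ∷ zs) t = let all = consistent⁻ z zs t in all ∷ pairs zs all
    where
    pairs : ∀ zs → All (R z) zs → AllPairs R zs
    pairs []       []       = []
    pairs (y ∷ ys) (r ∷ rs) = All.map (R.trans (R.sym r)) rs ∷ pairs ys rs

  composed : ∀ zs → T (consistent zs) → Word b × ℕ
  composed zs t = proj₁ (composes zs (consistent⇒AllPairs zs t))

  distilled : ∀ zs → T (consistent zs) → Word b × ℕ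
  distilled zs t = kernel (composed zs t)

  distilled⟹ : (λ ((zs , _) : Σ[ zs ∈ List⁺ (Word l) ] T (consistent zs)) → encode zs) ⟹
               (λ (zs , t) → encode (distilled zs t))
  distilled⟹ = record
    { program = compose
    ; time    = λ n → eval timeBound (n * n)
    ; isPoly  = eval-∘-isPoly timeBound (*-isPoly id-isPoly id-isPoly)
    ; runs    = λ (zs , t) → Run-≤ (eval-mono timeBound (size-list≤ zs))
                                   (proj₁ (proj₂ (composes zs (consistent⇒AllPairs zs t))))
    } ▸ reindex (λ (zs , t) → composed zs t)
          (fromPolyTime {f = kernel} (+-isPoly id-isPoly id-isPoly) size-instance≤ kernel-polyTime)

  distilled⁺ : ∀ zs t → Any L (toList zs) → Q (distilled zs t)
  distilled⁺ zs t p = Equivalence.to (equivalent _)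
    (Equivalence.from (proj₁ (proj₂ (proj₂ (composes zs (consistent⇒AllPairs zs t))))) p)

  distilled⁻ : ∀ zs t → Q (distilled zs t) → Any L (toList zs)
  distilled⁻ zs t q = Equivalence.to (proj₁ (proj₂ (proj₂ (composes zs (consistent⇒AllPairs zs t)))))
    (Equivalence.from (equivalent _) q)

  -- A list of inputs distils to an instance of Q that is a yes-instance
  -- iff A contains one of the inputs, so a list that contains x and
  -- distils to a no-instance certifies x ∉ A.

  DistilsTo : List (Word a) → Word b × ℕ → Set
  DistilsTo []       y = ⊥
  DistilsTo (x ∷ xs) y = Σ[ t ∈ T (consistent (images (x ∷ xs))) ] distilled (images (x ∷ xs)) t ≡ y

  DistilsTo? : ∀ xs y → Dec (DistilsTo xs y)
  DistilsTo? []       y = no λ ()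
  DistilsTo? (x ∷ xs) y with T? (consistent (images (x ∷ xs)))
  ... | no ¬t = no (¬t ∘ proj₁)
  -- The instance formally depends on the proof of consistency, but any two such proofs are equal.
  ... | yes t = map′ (t ,_) (λ (t′ , eq) → trans (cong (distilled (images (x ∷ xs))) (T-irrelevant t t′)) eq)
                     (≡-dec (List-≡-dec _≟ᶠ_) _≟_ (distilled (images (x ∷ xs)) t) y)

  DistilsTo⁺ : ∀ xs {y} → DistilsTo xs y → Any A xs → Q y
  DistilsTo⁺ (x ∷ xs) (t , refl) p =
    distilled⁺ _ t (Any-images⁺ (x ∷ xs) (Any.map (λ {x} → Equivalence.to (f-reduces x)) p))

  DistilsTo⁻ : ∀ xs {y} → DistilsTo xs y → Q y → Any A xs
  DistilsTo⁻ (x ∷ xs) (t , refl) q =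
    Any.map (λ {x} → Equivalence.from (f-reduces x)) (Any-images⁻ (x ∷ xs) (distilled⁻ _ t q))

  -- The verifier

  module InputMember  = Member {Word a} {Word a} encode thin-word encode
  module AdviceMember = Member {Word b × ℕ} {Tree} encode (thin-∙ thin-word thin-ℕ) id

  inputs : Word (suc a) → List⁺ (Word a)
  inputs = ListCode.decode

  noInstances : Word 2 → List Tree
  noInstances s = spine (TreeCode.decode s)

  -- Neither `Q` nor non-membership of the listed inputs in `A` is checked; that the outcome is a
  -- no-instance rests on the advice alone.
  verify : (Word a × Word 2) × Word (suc a) → Bool
  verify ((x , s) , w) =
    andThen (InputMember.member (x , toList (inputs w))) λ _ →
    andThen (consistent (images (inputs w))) λ t →
    AdviceMember.member (distilled (images (inputs w)) t , noInstances s)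

  verify⟹ : (λ (i : (Word a × Word 2) × Word (suc a)) → encode i) ⟹ (λ i → encodeBool (verify i))
  verify⟹ = guard⟹
    (⟨ assign⟹ (head (head var))
     , assign⟹ (tail var) ▸ reindex (λ (_ , w) → w) ListCode.decode⟹
     ⟩⟹ ▸ reindex (λ ((x , _) , w) → x , toList (inputs w)) InputMember.member⟹)
    (guard⟹
      (assign⟹ (tail var) ▸ reindex (λ ((_ , w) , _) → w) ListCode.decode⟹
        ▸ reindex (λ ((_ , w) , _) → inputs w) images⟹
        ▸ reindex (λ ((_ , w) , _) → images (inputs w)) consistent⟹)
      (⟨ assign⟹ (tail var) ▸ reindex (λ (((_ , w) , _) , _) → w) ListCode.decode⟹
         ▸ reindex (λ (((_ , w) , _) , _) → inputs w) images⟹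
         ▸ reindex (λ (((_ , w) , _) , t) → images (inputs w) , t) distilled⟹
       , ⟹-resp (assign⟹ (tail (head var)) ▸ reindex (λ ((((_ , s) , _) , _) , _) → s) TreeCode.decode⟹)
                (λ ((((_ , s) , _) , _) , _) → sym (encodeList-spine (TreeCode.decode s)))
       ⟩⟹ ▸ reindex (λ ((((_ , s) , w) , _) , t) → distilled (images (inputs w)) t , noInstances s)
              AdviceMember.member⟹))

  verify-polyTime : PolyTime verify
  verify-polyTime = toPolyTime {f = verify} {h = λ n → n + (2 + (a + 2 + suc a))} (+-isPoly id-isPoly (const-isPoly _))
    (λ ((x , s) , w) → ≤-trans
      (s≤s (≤-trans (m⊔n≤m+n (depth (encode x ∙ encode s)) _) (+-mono-≤
        (s≤s (≤-trans (m⊔n≤m+n (depth (encode x)) _) (+-mono-≤ (depth-word≤ x) (depth-word≤ s))))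
        (depth-word≤ w))))
      (≤-reflexive (lemma (length x) (length s) (length w) a)))
    verify⟹
    where
    lemma : ∀ x s w a → 2 + (x + a + (s + 2) + (w + (1 + a))) ≡ x + s + w + (2 + (a + 2 + (1 + a)))
    lemma = solve-∀

  verify⁻ : ∀ x s w → T (verify ((x , s) , w)) →
            ∃[ xs ] ∃[ y ] x ∈ xs × DistilsTo xs y × encode y ∈ noInstances s
  verify⁻ x s w v with T-andThen⁻ (InputMember.member (x , toList (inputs w))) v
  ... | m , v′ with T-andThen⁻ (consistent (images (inputs w))) v′
  ...   | t , n = toList (inputs w) , distilled (images (inputs w)) t
                , Any.map (λ {y} → encode-word-injective x y) (InputMember.member⁻ x _ m)
                , distils (inputs w) t
                , AdviceMember.member⁻ _ _ n
    where
    distils : ∀ xs t → DistilsTo (toList xs) (distilled (images xs) t)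
    distils (x ∷ xs) t = t , refl

  verify⁺ : ∀ x s z zs y → x ∈ z ∷ zs → DistilsTo (z ∷ zs) y → encode y ∈ noInstances s →
            T (verify ((x , s) , ListCode.code (z ∷ zs)))
  verify⁺ x s z zs y x∈ (t , refl) y∈ rewrite ListCode.decode-code (z ∷ zs) =
    T-andThen⁺ (InputMember.member (x , z ∷ zs)) (InputMember.member⁺ x _ (Any.map (cong encode) x∈))
      (T-andThen⁺ (consistent (images (z ∷ zs))) t (AdviceMember.member⁺ _ _ y∈))

  -- The number of composed inputs exceeds the description length of the
  -- resulting kernel; this is possible because the size of the kernel
  -- depends only on the logarithm of that number.

  imageBound : ℕ → ℕ
  imageBound n = n + a + time f⟹ (n + a)

  imageBound-isPoly : IsPoly imageBound
  imageBound-isPoly = +-isPoly +a-isPoly (∘-isPoly (isPoly f⟹) +a-isPoly)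
    where
    +a-isPoly : IsPoly (_+ a)
    +a-isPoly = +-isPoly id-isPoly (const-isPoly a)

  length-f≤ : ∀ {n x} → length x ≤ n → length (f x) ≤ imageBound n
  length-f≤ {n} {x} len = ≤-trans (length-word≤ (f x))
    (≤-trans (depth-⟹ f⟹ x) (+-mono-≤ depth≤ (mono (isPoly f⟹) depth≤)))
    where
    depth≤ : depth (encode x) ≤ n + a
    depth≤ = ≤-trans (depth-word≤ x) (+-monoˡ-≤ a len)

  -- One `v * v` stands for the length of the longest image, the other for the logarithm of the
  -- number of composed inputs.
  kernelSize : ℕ → ℕ
  kernelSize v = eval kernelBound (eval parameterBound (v * v + v * v))

  kernelSize-isPoly : IsPoly kernelSize
  kernelSize-isPoly = eval-∘-isPoly kernelBound (eval-∘-isPoly parameterBound (+-isPoly v² v²))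
    where
    v² : IsPoly (λ v → v * v)
    v² = *-isPoly id-isPoly id-isPoly

  -- With `K = kernelSize v` there are at most `2 ^ (b * K)` words of length up to `K` and at most
  -- `2 ^ K` numbers up to `K`; the successor makes the count of outcomes strictly smaller than
  -- `2 ^ inputCount v`.
  inputCount : ℕ → ℕ
  inputCount v = suc (b * kernelSize v + kernelSize v)

  inputCount-isPoly : IsPoly inputCount
  inputCount-isPoly = +-isPoly (const-isPoly 1)
    (+-isPoly (*-isPoly (const-isPoly b) kernelSize-isPoly) kernelSize-isPoly)

  -- `kernelSize` presupposes that the logarithm of `inputCount v` is at most `v * v`. This holds
  -- from `threshold` on, and `range` adds `threshold` to stay there.
  threshold : ℕ
  threshold = suc (proj₁ (polynomial-growth inputCount-isPoly))

  range : ℕ → ℕ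
  range n = imageBound n + threshold

  range-isPoly : IsPoly range
  range-isPoly = +-isPoly imageBound-isPoly (const-isPoly threshold)

  tupleLength outputBound : ℕ → ℕ
  tupleLength n = inputCount (range n)
  outputBound n = kernelSize (range n)

  DistilsTo-bounded : ∀ n xs {y} → DistilsTo xs y → length xs ≡ tupleLength n →
                      (∀ {x} → x ∈ xs → length x ≤ n) →
                      length (proj₁ y) ≤ outputBound n × proj₂ y ≤ outputBound n
  DistilsTo-bounded n (x ∷ xs) (t , refl) len ≤n = ≤-trans (proj₁ kernel≤) size≤ , ≤-trans (proj₂ kernel≤) size≤
    where
    zs : List⁺ (Word l)
    zs = images (x ∷ xs)
    v : ℕ
    v = range n
    kernel≤ : length (proj₁ (distilled zs t)) ≤ eval kernelBound (proj₂ (composed zs t)) ×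
              proj₂ (distilled zs t) ≤ eval kernelBound (proj₂ (composed zs t))
    kernel≤ = bounded _ _
    v≤v² : v ≤ v * v
    v≤v² = ≤-trans (≤-reflexive (sym (*-identityʳ v))) (*-monoʳ-≤ v (≤-trans (s≤s z≤n) (m≤n+m threshold (imageBound n))))
    image≤ : ∀ {z} → z ∈ toList zs → length z ≤ imageBound n
    image≤ z∈ with ∈-images⁻ (x ∷ xs) z∈
    ... | x , x∈ , refl = length-f≤ (≤n x∈)
    maxLength≤v² : maxLength (toList zs) ≤ v * v
    maxLength≤v² = ≤-trans (maxLength≤ (imageBound n) (toList zs) image≤) (≤-trans (m≤m+n _ threshold) v≤v²)
    log≤v² : ⌈log₂ length (toList zs) ⌉ ≤ v * v
    log≤v² = begin
      ⌈log₂ length (toList zs) ⌉   ≡⟨ cong ⌈log₂_⌉ (trans (length-images (x ∷ xs)) len) ⟩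
      ⌈log₂ tupleLength n ⌉        ≤⟨ ⌈log₂⌉-mono-≤ (proj₂ (polynomial-growth inputCount-isPoly) (imageBound n)) ⟩
      ⌈log₂ 2 ^ (v * v) ⌉          ≡⟨ ⌈log₂2^n⌉≡n (v * v) ⟩
      v * v                        ∎
      where open ≤-Reasoning
    size≤ : eval kernelBound (proj₂ (composed zs t)) ≤ outputBound n
    size≤ = eval-mono kernelBound (≤-trans
      (proj₂ (proj₂ (proj₂ (composes zs (consistent⇒AllPairs zs t)))))
      (eval-mono parameterBound (+-mono-≤ maxLength≤v² log≤v²)))

  outputs : ℕ → List (Word b × ℕ)
  outputs n = cartesianProduct (words≤ b (outputBound n)) (upTo (suc (outputBound n)))

  length-outputs< : ∀ n → length (outputs n) < 2 ^ tupleLength n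
  length-outputs< n = begin-strict
    length (outputs n)                                    ≡⟨ length-cartesianProductWith _,_ (words≤ b K) (upTo (suc K)) ⟩
    length (words≤ b K) * length (upTo (suc K))           ≡⟨ cong (length (words≤ b K) *_) (length-upTo (suc K)) ⟩
    length (words≤ b K) * suc K                           ≤⟨ *-mono-≤ (length-words≤ b K) (n<2^n K) ⟩
    2 ^ (b * K) * 2 ^ K                                   ≡⟨ ^-distribˡ-+-* 2 (b * K) K ⟨
    2 ^ (b * K + K)                                       <⟨ ^-monoʳ-< 2 (s≤s (s≤s z≤n)) (n<1+n (b * K + K)) ⟩
    2 ^ tupleLength n                                     ∎
    where
    open ≤-Reasoning
    K : ℕ
    K = outputBound n

  ∈-outputs : ∀ n {y : Word b × ℕ} → length (proj₁ y) ≤ outputBound n × proj₂ y ≤ outputBound n → y ∈ outputs n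
  ∈-outputs n {x , k} (x≤ , k≤) = ∈-cartesianProduct⁺ (∈-words≤ _ x x≤) (∈-upTo⁺ (s≤s k≤))

  -- Refutations, advice and certificates

  noInputs : ℕ → List (Word a)
  noInputs n = filter (λ x → ¬? (A? x)) (filter (λ x → length x ≟ n) (words≤ a n))

  ∈-noInputs⁺ : ∀ {n x} → length x ≡ n → ¬ A x → x ∈ noInputs n
  ∈-noInputs⁺ {n} {x} len ¬Ax = ∈-filter⁺ (λ x → ¬? (A? x))
    (∈-filter⁺ (λ x → length x ≟ n) (∈-words≤ n x (≤-reflexive len)) len) ¬Ax

  ∈-noInputs⁻ : ∀ {n x} → x ∈ noInputs n → length x ≡ n × ¬ A x
  ∈-noInputs⁻ {n} x∈ with ∈-filter⁻ (λ x → ¬? (A? x)) {xs = filter (λ x → length x ≟ n) (words≤ a n)} x∈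
  ... | x∈′ , ¬Ax = proj₂ (∈-filter⁻ (λ x → length x ≟ n) {xs = words≤ a n} x∈′) , ¬Ax

  -- The relation to which the covering argument is applied. A tuple wholly outside `A` makes `y` a
  -- no-instance; its fixed length bounds both `y` and the certificate.
  Refutes : ∀ n → Word a → Word b × ℕ → Set
  Refutes n x y = ∃[ xs ] length xs ≡ tupleLength n × All (_∈ noInputs n) xs × x ∈ xs × DistilsTo xs y

  Refutes? : ∀ n x y → Dec (Refutes n x y)
  Refutes? n x y
    with any? (λ xs → any? (List-≡-dec _≟ᶠ_ x) xs ×-dec DistilsTo? xs y) (tuples (noInputs n) (tupleLength n))
  ... | no ¬p = no λ (xs , len , ns , x∈ , d) → ¬p (lose (∈-tuples⁺ (tupleLength n) len ns) (x∈ , d))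
  ... | yes p with find p
  ...   | xs , xs∈ , x∈ , d with ∈-tuples⁻ (tupleLength n) xs∈
  ...     | len , ns = yes (xs , len , ns , x∈ , d)

  module _ (n : ℕ) where

    open Covering (Refutes n) (Refutes? n)

    class : Word l → List (Word a)
    class r = filter (λ x → R? (f x) r) (noInputs n)

    class⇒noInput : ∀ {r x} → x ∈ class r → x ∈ noInputs n
    class⇒noInput {r} x∈ = proj₁ (∈-filter⁻ (λ x → R? (f x) r) {xs = noInputs n} x∈)

    class⇒R : ∀ {r x} → x ∈ class r → R (f x) r
    class⇒R {r} x∈ = proj₂ (∈-filter⁻ (λ x → R? (f x) r) {xs = noInputs n} x∈)

    -- The tuple itself refutes each of its members, and its distilled instance is the common
    -- column.
    class-tuple-covered : ∀ r xs → length xs ≡ tupleLength n → All (_∈ class r) xs →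
                          ∃[ y ] y ∈ outputs n × All (λ x → Refutes n x y) xs
    class-tuple-covered r (x ∷ xs) len xs⊆@(x∈ ∷ xs∈) =
      distilled zs t
      , ∈-outputs n (DistilsTo-bounded n (x ∷ xs) (t , refl) len
          (λ x∈ → ≤-reflexive (proj₁ (∈-noInputs⁻ (All.lookup ns x∈)))))
      , All.tabulate (λ x∈ → x ∷ xs , len , ns , x∈ , t , refl)
      where
      zs : List⁺ (Word l)
      zs = images (x ∷ xs)
      ns : All (_∈ noInputs n) (x ∷ xs)
      ns = All.map class⇒noInput xs⊆
      same-class : ∀ {z} → z ∈ toList zs → R z r
      same-class z∈ with ∈-images⁻ (x ∷ xs) z∈
      ... | _ , x∈ , refl = class⇒R (All.lookup xs⊆ x∈)
      t : T (consistent zs)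
      t = consistent⁺ (f x) _ (All.tabulate (λ z∈ → R.trans (class⇒R x∈) (R.sym (same-class (there z∈)))))

    -- Only inputs with equivalent images can be composed, so the classes are covered one by one.
    -- Each has at most `2 ^ (a * n)` elements, whence `suc (a * n)` instances per class.
    cover-classes : ∀ reps → ∃[ ys ] length ys ≤ length reps * suc (a * n) × All (λ y → ∃[ x ] Refutes n x y) ys ×
                    (∀ {x} → x ∈ noInputs n → Any (R (f x)) reps → Any (Refutes n x) ys)
    cover-classes []         = [] , z≤n , [] , λ _ ()
    cover-classes (r ∷ reps)
      with cover (class r) (outputs n) (tupleLength n) (length-outputs< n) (class-tuple-covered r)
                 (suc (a * n)) (class r) length-class< id
         | cover-classes reps
      where
      length-class< : length (class r) < 2 ^ suc (a * n)
      length-class< = begin-strict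
        length (class r)                                     ≤⟨ length-filter _ (noInputs n) ⟩
        length (noInputs n)                                  ≤⟨ length-filter _ (filter (λ x → length x ≟ n) (words≤ a n)) ⟩
        length (filter (λ x → length x ≟ n) (words≤ a n))    ≤⟨ length-filter _ (words≤ a n) ⟩
        length (words≤ a n)                                  ≤⟨ length-words≤ a n ⟩
        2 ^ (a * n)                                          <⟨ ^-monoʳ-< 2 (s≤s (s≤s z≤n)) (n<1+n (a * n)) ⟩
        2 ^ suc (a * n)                                      ∎
        where open ≤-Reasoning
    ... | ys , len , good , covers | ys′ , len′ , good′ , covers′ =
      ys ++ ys′
      , ≤-trans (≤-reflexive (length-++ ys)) (+-mono-≤ len len′)
      , All.++⁺ good good′
      , λ { x∈ (here p)  → Any.++⁺ˡ (covers (∈-filter⁺ (λ x → R? (f x) r) x∈ p))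
          ; x∈ (there p) → Any.++⁺ʳ ys (covers′ x∈ p) }

    classCount : ℕ
    classCount = eval classBound (imageBound n)

    abstract
      -- The bound on the number of classes depends on the length of the images and not on how many
      -- there are, so even exponentially many inputs meet polynomially many classes.
      refutations : ∃[ ys ] length ys ≤ classCount * suc (a * n) × All (λ y → ∃[ x ] Refutes n x y) ys ×
                    (∀ {x} → x ∈ noInputs n → Any (Refutes n x) ys)
      refutations =
        let reps , few , classified = fewClasses (map f (noInputs n))
            ys , len , good , covers = cover-classes reps
        in ys
         , ≤-trans len (*-monoˡ-≤ (suc (a * n)) (≤-trans few (eval-mono classBound (maxLength≤ (imageBound n) _ image≤))))
         , good
         , λ x∈ → covers x∈ (All.lookup (All.map⁻ classified) x∈)
        where
        image≤ : ∀ {z} → z ∈ map f (noInputs n) → length z ≤ imageBound n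
        image≤ z∈ with ∈-map⁻ f z∈
        ... | x , x∈ , refl = length-f≤ (≤-reflexive (proj₁ (∈-noInputs⁻ x∈)))

    refuters : List (Word b × ℕ)
    refuters = proj₁ refutations

    advice : Word 2
    advice = TreeCode.code (encodeList (map encode refuters))

  noInstances-advice : ∀ n → noInstances (advice n) ≡ map encode (refuters n)
  noInstances-advice n = trans (cong spine (TreeCode.decode-code _)) (spine-encodeList _)

  -- A bound on the nodes of an encoded instance with word length and parameter at most `k`: the
  -- root, the word, the number.
  refuterSize : ℕ → ℕ
  refuterSize k = suc (k * suc (2 * b + 1) + 1 + (2 * k + 1))

  refuterSize-isPoly : IsPoly refuterSize
  refuterSize-isPoly = +-isPoly (const-isPoly 1) (+-isPoly
    (+-isPoly (*-isPoly id-isPoly (const-isPoly (suc (2 * b + 1)))) (const-isPoly 1))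
    (+-isPoly (*-isPoly (const-isPoly 2) id-isPoly) (const-isPoly 1)))

  adviceBound : ℕ → ℕ
  adviceBound n = classCount n * suc (a * n) * suc (refuterSize (outputBound n)) + 1

  adviceBound-isPoly : IsPoly adviceBound
  adviceBound-isPoly = +-isPoly
    (*-isPoly (*-isPoly (eval-∘-isPoly classBound imageBound-isPoly)
                        (+-isPoly (const-isPoly 1) (*-isPoly (const-isPoly a) id-isPoly)))
              (+-isPoly (const-isPoly 1) (∘-isPoly refuterSize-isPoly (∘-isPoly kernelSize-isPoly range-isPoly))))
    (const-isPoly 1)

  length-advice≤ : ∀ n → length (advice n) ≤ adviceBound n
  length-advice≤ n = begin
    length (advice n)                                           ≡⟨ TreeCode.length-code _ ⟩
    nodes (encodeList (map encode (refuters n)))                ≤⟨ nodes-encodeList≤ encode _ (refuters n) nodes≤ ⟩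
    length (refuters n) * suc (refuterSize (outputBound n)) + 1 ≤⟨ +-monoˡ-≤ 1 (*-monoˡ-≤ _ (proj₁ (proj₂ (refutations n)))) ⟩
    adviceBound n                                               ∎
    where
    open ≤-Reasoning
    nodes≤ : ∀ {y} → y ∈ refuters n → nodes (encode y) ≤ refuterSize (outputBound n)
    nodes≤ {x , k} y∈ with All.lookup (proj₁ (proj₂ (proj₂ (refutations n)))) y∈
    ... | _ , xs , len , ns , _ , d with DistilsTo-bounded n xs d len (λ x∈ → ≤-reflexive (proj₁ (∈-noInputs⁻ (All.lookup ns x∈))))
    ...   | x≤ , k≤ = s≤s (+-mono-≤
      (≤-trans (nodes-word≤ x) (+-monoˡ-≤ 1 (*-monoˡ-≤ (suc (2 * b + 1)) x≤)))
      (≤-trans (≤-reflexive (nodes-encodeℕ k)) (+-monoˡ-≤ 1 (*-monoʳ-≤ 2 k≤))))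

  certificateBound-isPoly : IsPoly (λ n → tupleLength n * suc n)
  certificateBound-isPoly = *-isPoly (∘-isPoly inputCount-isPoly range-isPoly) (+-isPoly (const-isPoly 1) id-isPoly)

  certificateBound : Poly
  certificateBound = proj₁ certificateBound-isPoly

  Certified : Word a × Word 2 → Set
  Certified i = ∃[ w ] length w ≤ eval certificateBound (size i) × T (verify (i , w))

  Certified? : ∀ i → Dec (Certified i)
  Certified? i = certified? (λ w → verify (i , w)) (eval certificateBound (size i))

  -- If `x` were in `A`, the certificate would make `y` a yes-instance. But `y` is in the advice, so
  -- a tuple outside `A` distils to it as well, and one member of that tuple would have to lie in
  -- `A`.
  certified-sound : ∀ x → Certified (x , advice (length x)) → ¬ A x
  certified-sound x (w , _ , v) Ax with verify⁻ x (advice (length x)) w v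
  ... | xs , y , x∈ , d , y∈
    with ∈-map⁻ encode (subst (encode y ∈_) (noInstances-advice (length x)) y∈)
  ...   | y′ , y′∈ , eq with encode-instance-injective y y′ eq
  ...     | refl with All.lookup (proj₁ (proj₂ (proj₂ (refutations (length x))))) y′∈
  ...       | _ , xs′ , _ , ns , _ , d′
    with find (DistilsTo⁻ xs′ d′ (DistilsTo⁺ xs d (lose x∈ Ax)))
  ...         | z , z∈ , Az = proj₂ (∈-noInputs⁻ {length x} (All.lookup ns z∈)) Az

  certified-complete : ∀ x → ¬ A x → Certified (x , advice (length x))
  certified-complete x ¬Ax
    with find (proj₂ (proj₂ (proj₂ (refutations (length x)))) (∈-noInputs⁺ {length x} refl ¬Ax))
  ... | y , y∈ , z ∷ zs , len , ns , x∈ , d =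
    ListCode.code (z ∷ zs)
    , (begin
        length (ListCode.code (z ∷ zs))                          ≤⟨ ListCode.length-code≤ n (z ∷ zs) (All.map (≤-reflexive ∘ proj₁ ∘ ∈-noInputs⁻ {n}) ns) ⟩
        length (z ∷ zs) * suc n                                  ≡⟨ cong (_* suc n) len ⟩
        tupleLength n * suc n                                    ≡⟨ proj₂ certificateBound-isPoly n ⟩
        eval certificateBound n                                  ≤⟨ eval-mono certificateBound (m≤m+n n _) ⟩
        eval certificateBound (size (x , advice n))              ∎)
    , verify⁺ x (advice n) z zs y x∈ d (subst (encode y ∈_) (sym (noInstances-advice n)) (∈-map⁺ encode y∈))
    where
    open ≤-Reasoning
    n : ℕ
    n = length x

  A∈coNP/poly : coNP/poly A
  A∈coNP/poly =
    2 , advice , proj₁ adviceBound-isPoly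
    , (λ n → ≤-trans (length-advice≤ n) (≤-reflexive (proj₂ adviceBound-isPoly n)))
    -- `coNP` refers to the complement, here `¬ ¬ Certified i`; bounded search decides `Certified`
    -- and so removes the double negation.
    , (λ i → ¬ Certified i)
    , (suc a , verify , certificateBound , verify-polyTime
      , λ i → mk⇔ (decidable-stable (Certified? i)) (λ c ¬c → ¬c c))
    , λ x → mk⇔ (λ Ax c → certified-sound x c Ax)
                (λ ¬c → decidable-stable (A? x) (¬c ∘ certified-complete x))

-- Exhaustive search is good enough, as the decision serves to construct the advice and to reason
-- about it, and never runs inside a program.
NP-decidable : ∀ {a} (A : Language a) → NP A → ∀ x → Dec (A x)
NP-decidable A (_ , verify , p , _ , correct) x =
  map′ (Equivalence.from (correct x)) (Equivalence.to (correct x))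
       (certified? (λ w → verify (x , w)) (eval p (size x)))

corollary10 : ∀ {a b : ℕ} (L : Language a) (Q : ParameterizedProblem b) → NPHard L → CrossComposition L Q → PolynomialKernel Q → NP⊆coNP/poly
corollary10 L Q hard crossComposition polynomialKernel A A∈NP =
  let f , f-polyTime , f-reduces = hard A A∈NP
  in Reduction.A∈coNP/poly crossComposition polynomialKernel A (NP-decidable A A∈NP) f f-polyTime f-reduces
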